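{- As $n \to \infty$, $$ex\bigl(n, n^{2/3}, \{C_4, \theta_{3,4}\}\bigr) = \Theta\bigl(n^{1+\frac{1}{9}}\bigr).$$ That is, there exist constants $c_1, c_2 > 0$ and $n_0$ such that for all integers $n \geq n_0$, $$c_1 n^{1+\frac{1}{9}} \leq ex\bigl(n, \lfloor n^{2/3} \rfloor, \{C_4, \theta_{3,4}\}\bigr) \leq c_2 n^{1+\frac{1}{9}}.$$
   Context: For a family $\mathcal{F}$ of graphs, $ex(a,b,\mathcal{F})$ is the maximum number of edges in a bipartite graph whose part sizes are $a$ and $b$ and which contains no graph in $\mathcal{F}$ as a (not necessarily induced) subgraph. $C_4$ is the cycle of length 4. $\theta_{3,4}$ is the theta graph consisting of two vertices joined by $4$ internally vertex-disjoint paths, each with exactly 3 edges. When a part size is given by a non-integer real number, it is rounded down to an integer. -}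

module Defs where

import Algebra.Definitions.RawSemiring as RawSemiringDefs
open import Data.Empty using (⊥)
open import Data.Fin using (Fin; zero; suc; toℕ; combine; finToFun; funToFin)
open import Data.Fin.Properties using (+↔⊎; *↔×; finToFun-funToFin; any?; all?)
  renaming (_≟_ to _≟ᶠ_)
open import Data.Fin.Subset using (Subset; ∣_∣; _∈_)
open import Data.Fin.Subset.Properties using (_∈?_; anySubset?; ∣p∣≤n)
open import Data.Integer using (+_)
open import Data.List using (List)
open import Data.List.Relation.Unary.All as All using (All)
open import Data.Nat using (ℕ; zero; suc; _*_; _∸_; _^_; _≤_; _<_; _%_; z≤n; s≤s; NonZero; NonTrivial)
open import Data.Nat.Properties using (≤-refl; ≤-trans; ≤-pred; _≤?_; ≤∧≢⇒<; ≰⇒>; <⇒≱; m≤m*n; m^n≢0)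
  renaming (_≟_ to _≟ⁿ_)
open import Data.Product using (Σ; ∃-syntax; _×_; _,_)
open import Data.Rational using (ℚ; +-*-rawSemiring)
  renaming (_≤_ to _≤ℚ_; _*_ to _*ℚ_; _/_ to _/ℚ_)
open import Data.Sum using (_⊎_; inj₁; inj₂; swap)
open import Data.Sum.Function.Propositional using (_⊎-↔_)
open import Function using (_∘_; _↔_; Inverse; Injective)
open import Function.Construct.Composition using (_↔-∘_)
open import Function.Construct.Identity using (↔-id)
open import Function.Construct.Symmetry using (↔-sym)
open import Level using (Level; 0ℓ)
open import Relation.Binary using (Rel; Symmetric; Irreflexive; DecidableEquality)
  renaming (Decidable to Decidable₂)
open import Relation.Binary.PropositionalEquality using (_≡_; _≢_; refl; sym; trans; cong; subst; subst₂)
open import Relation.Nullary using (¬_; Dec; yes; no; ¬?; _×-dec_; _⊎-dec_; _→-dec_)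
open import Relation.Nullary.Decidable using (map′)
open import Relation.Unary using (Pred; Decidable)

open RawSemiringDefs +-*-rawSemiring using () renaming (_^_ to _^ℚ_)

private variable
  ℓ : Level

------------------------------------------------------------------------
-- Bounded search

-- The largest m ≤ b satisfying P, and 0 if there is none.
greatest : {P : Pred ℕ ℓ} → Decidable P → ℕ → ℕ
greatest P? zero = 0
greatest P? (suc b) with P? (suc b)
... | yes _ = suc b
... | no  _ = greatest P? b

greatest-holds : {P : Pred ℕ ℓ} (P? : Decidable P) (b : ℕ) {m : ℕ} →
                 m ≤ b → P m → P (greatest P? b)
greatest-holds P? zero z≤n pm = pm
greatest-holds {P = P} P? (suc b) {m} m≤ pm with P? (suc b)
... | yes p = p
... | no ¬p = greatest-holds P? b (≤-pred (≤∧≢⇒< m≤ (λ eq → ¬p (subst P eq pm)))) pm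

greatest-upper : {P : Pred ℕ ℓ} (P? : Decidable P) (b : ℕ) {m : ℕ} →
                 m ≤ b → P m → m ≤ greatest P? b
greatest-upper P? zero m≤ pm = m≤
greatest-upper {P = P} P? (suc b) m≤ pm with P? (suc b)
... | yes _ = m≤
... | no ¬p = greatest-upper P? b (≤-pred (≤∧≢⇒< m≤ (λ eq → ¬p (subst P eq pm)))) pm

------------------------------------------------------------------------
-- Finite simple graphs

record Graph : Set₁ where
  infix 4 _∼_ _∼?_
  field
    Vertex      : Set
    order       : ℕ
    enumeration : Vertex ↔ Fin order
    _∼_         : Rel Vertex 0ℓ
    _∼?_        : Decidable₂ _∼_
    ∼-sym       : Symmetric _∼_
    ∼-irrefl    : Irreflexive _≡_ _∼_

  index : Vertex → Fin order
  index = Inverse.to enumeration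

  vertex : Fin order → Vertex
  vertex = Inverse.from enumeration

  vertex-index : ∀ x → vertex (index x) ≡ x
  vertex-index x = Inverse.inverseʳ enumeration refl

≟-via : {V : Set} {k : ℕ} → V ↔ Fin k → DecidableEquality V
≟-via e x y = map′ (λ eq → trans (sym (Inverse.inverseʳ e refl))
                             (trans (cong (Inverse.from e) eq) (Inverse.inverseʳ e refl)))
                   (cong (Inverse.to e))
                   (Inverse.to e x ≟ᶠ Inverse.to e y)

-- The simple graph in which distinct x and y are adjacent iff S x y or S y x.
fromRelation : {V : Set} {k : ℕ} → V ↔ Fin k → (S : Rel V 0ℓ) → Decidable₂ S → Graph
fromRelation {V} {k} e S S? = record
  { Vertex      = V
  ; order       = k
  ; enumeration = e
  ; _∼_         = λ x y → x ≢ y × (S x y ⊎ S y x)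
  ; _∼?_        = λ x y → ¬? (≟-via e x y) ×-dec (S? x y ⊎-dec S? y x)
  ; ∼-sym       = λ (x≢y , s) → (x≢y ∘ sym) , swap s
  ; ∼-irrefl    = λ x≡y (x≢y , _) → x≢y x≡y
  }

-- H ⊑ G: G contains a, not necessarily induced, copy of H.
infix 4 _⊑_ _⊑?_
IsCopy : (H G : Graph) → (Graph.Vertex H → Graph.Vertex G) → Set
IsCopy H G f = Injective _≡_ _≡_ f × (∀ {x y} → x H.∼ y → f x G.∼ f y)
  where module H = Graph H
        module G = Graph G

_⊑_ : Graph → Graph → Set
H ⊑ G = ∃[ f ] IsCopy H G f

all-vertices? : (H : Graph) {P : Pred (Graph.Vertex H) 0ℓ} → Decidable P → Dec (∀ x → P x)
all-vertices? H {P} P? = map′ (λ f x → subst P (vertex-index x) (f (index x)))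
                              (λ f i → f (vertex i))
                              (all? (P? ∘ vertex))
  where open Graph H

isCopy? : (H G : Graph) (f : Graph.Vertex H → Graph.Vertex G) → Dec (IsCopy H G f)
isCopy? H G f =
  map′ (λ g {x} {y} → g x y) (λ g x y → g {x} {y})
       (all-vertices? H λ x → all-vertices? H λ y →
          ≟-via G.enumeration (f x) (f y) →-dec ≟-via H.enumeration x y)
  ×-dec
  map′ (λ g {x} {y} → g x y) (λ g x y → g {x} {y})
       (all-vertices? H λ x → all-vertices? H λ y → (x H.∼? y) →-dec (f x G.∼? f y))
  where module H = Graph H
        module G = Graph G

_⊑?_ : (H G : Graph) → Dec (H ⊑ G)
H ⊑? G = map′ (λ (c , p) → decode c , p)
              (λ (f , inj , hom) → encode f ,
                (λ {x} {y} eq → inj (subst₂ _≡_ (decode-encode f x) (decode-encode f y) eq)) ,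
                (λ {x} {y} x∼y → subst₂ G._∼_ (sym (decode-encode f x)) (sym (decode-encode f y)) (hom x∼y)))
              (any? (λ c → isCopy? H G (decode c)))
  where
  module H = Graph H
  module G = Graph G

  decode : Fin (G.order ^ H.order) → H.Vertex → G.Vertex
  decode c x = G.vertex (finToFun c (H.index x))

  encode : (H.Vertex → G.Vertex) → Fin (G.order ^ H.order)
  encode f = funToFin (G.index ∘ f ∘ H.vertex)

  decode-encode : ∀ f x → decode (encode f) x ≡ f x
  decode-encode f x =
    trans (cong G.vertex (finToFun-funToFin (G.index ∘ f ∘ H.vertex) (H.index x)))
      (trans (G.vertex-index _) (cong f (H.vertex-index x)))

Free : List Graph → Graph → Set₁
Free ℱ G = All (λ H → ¬ (H ⊑ G)) ℱ

free? : ∀ ℱ G → Dec (Free ℱ G)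
free? ℱ G = All.all? (λ H → ¬? (H ⊑? G)) ℱ

------------------------------------------------------------------------
-- Cycles and theta graphs

-- The cycle of length k, meaningful for k ≥ 3.
Cycle : (k : ℕ) .{{_ : NonZero k}} → Graph
Cycle k = fromRelation (↔-id (Fin k))
  (λ i j → toℕ j ≡ suc (toℕ i) % k)
  (λ i j → toℕ j ≟ⁿ suc (toℕ i) % k)

-- inner p i is the internal vertex at distance i + 1 from source on the
-- p-th of the t paths; a path with k edges has k ∸ 1 internal vertices.
ThetaVertex : ℕ → ℕ → Set
ThetaVertex k t = Fin 2 ⊎ (Fin t × Fin (k ∸ 1))

pattern source    = inj₁ zero
pattern target    = inj₁ (suc zero)
pattern inner p i = inj₂ (p , i)

ThetaStep : ∀ k t → Rel (ThetaVertex k t) 0ℓ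
ThetaStep k t source      (inner p i) = toℕ i ≡ 0
ThetaStep k t (inner p i) (inner q j) = p ≡ q × toℕ j ≡ suc (toℕ i)
ThetaStep k t (inner p i) target      = suc (toℕ i) ≡ k ∸ 1
ThetaStep k t source      (inj₁ _)    = ⊥
ThetaStep k t target      _           = ⊥
ThetaStep k t (inner p i) source      = ⊥

thetaStep? : ∀ k t → Decidable₂ (ThetaStep k t)
thetaStep? k t source      (inner p i) = toℕ i ≟ⁿ 0
thetaStep? k t (inner p i) (inner q j) = (p ≟ᶠ q) ×-dec (toℕ j ≟ⁿ suc (toℕ i))
thetaStep? k t (inner p i) target      = suc (toℕ i) ≟ⁿ k ∸ 1
thetaStep? k t source      (inj₁ _)    = no λ ()
thetaStep? k t target      _           = no λ ()
thetaStep? k t (inner p i) source      = no λ ()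

-- Two vertices joined by t internally disjoint paths with k ≥ 2 edges each.
Theta : (k t : ℕ) .{{_ : NonTrivial k}} → Graph
Theta k t = fromRelation
  (↔-sym +↔⊎ ↔-∘ (↔-id (Fin 2) ⊎-↔ ↔-sym *↔×))
  (ThetaStep k t) (thetaStep? k t)

------------------------------------------------------------------------
-- Bipartite extremal numbers

-- A bipartite graph with parts Fin a and Fin b is given by its edge set, a
-- set of pairs (i , j) coded by combine : Fin a → Fin b → Fin (a * b).  As
-- combine is a bijection on pairs, ∣ E ∣ is the number of edges.
BipartiteEdges : ℕ → ℕ → Set
BipartiteEdges a b = Subset (a * b)

bipartite : ∀ a b → BipartiteEdges a b → Graph
bipartite a b E = fromRelation (↔-sym (+↔⊎ {a} {b})) S S?
  where
  S : Rel (Fin a ⊎ Fin b) 0ℓ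
  S (inj₁ i) (inj₂ j) = combine i j ∈ E
  S (inj₁ _) (inj₁ _) = ⊥
  S (inj₂ _) _        = ⊥

  S? : Decidable₂ S
  S? (inj₁ i) (inj₂ j) = combine i j ∈? E
  S? (inj₁ _) (inj₁ _) = no λ ()
  S? (inj₂ _) _        = no λ ()

-- Some ℱ-free bipartite graph with parts of sizes a and b has exactly e edges.
Attainable : ∀ a b → List Graph → ℕ → Set₁
Attainable a b ℱ e = Σ (BipartiteEdges a b) λ E → Free ℱ (bipartite a b E) × ∣ E ∣ ≡ e

attainable? : ∀ a b ℱ → Decidable (Attainable a b ℱ)
attainable? a b ℱ e = anySubset? (λ E → free? ℱ (bipartite a b E) ×-dec (∣ E ∣ ≟ⁿ e))

-- The maximum number of edges (at most a * b) of an ℱ-free bipartite graph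
-- with parts of sizes a and b; 0 if there is no such graph, which happens only
-- if ℱ has an edgeless member.
ex : ℕ → ℕ → List Graph → ℕ
ex a b ℱ = greatest (attainable? a b ℱ) (a * b)

ex-attained : ∀ {a b ℱ} (E : BipartiteEdges a b) → Free ℱ (bipartite a b E) →
              Attainable a b ℱ (ex a b ℱ)
ex-attained {a} {b} {ℱ} E free =
  greatest-holds (attainable? a b ℱ) (a * b) (∣p∣≤n E) (E , free , refl)

ex-upper : ∀ {a b ℱ} (E : BipartiteEdges a b) → Free ℱ (bipartite a b E) →
           ∣ E ∣ ≤ ex a b ℱ
ex-upper {a} {b} {ℱ} E free =
  greatest-upper (attainable? a b ℱ) (a * b) (∣p∣≤n E) (E , free , refl)

------------------------------------------------------------------------
-- Rational powers of natural numbers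

-- ⌊ n ^ p / q ⌋ is the integer part of the real number n^(p/q), q ≥ 1.
-- The bound n ^ p suffices because m ≤ m ^ q.
⌊_^_/_⌋ : (n p q : ℕ) .{{_ : NonZero q}} → ℕ
⌊ n ^ p / q ⌋ = greatest (λ m → m ^ q ≤? n ^ p) (n ^ p)

private
  m≤m^q : ∀ m q .{{_ : NonZero q}} → m ≤ m ^ q
  m≤m^q zero    q       = z≤n
  m≤m^q (suc m) (suc q) = m≤m*n (suc m) (suc m ^ q) {{m^n≢0 (suc m) q}}

floor-lower : ∀ n p q .{{_ : NonZero q}} → ⌊ n ^ p / q ⌋ ^ q ≤ n ^ p
floor-lower n p (suc q) = greatest-holds (λ m → m ^ suc q ≤? n ^ p) (n ^ p) {0} z≤n z≤n

floor-upper : ∀ n p q .{{_ : NonZero q}} → n ^ p < suc ⌊ n ^ p / q ⌋ ^ q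
floor-upper n p q = ≰⇒> λ le →
  <⇒≱ (s≤s ≤-refl)
      (greatest-upper (λ m → m ^ q ≤? n ^ p) (n ^ p) (≤-trans (m≤m^q _ q) le) le)

fromℕ : ℕ → ℚ
fromℕ n = + n /ℚ 1

-- For rational c ≥ 0 and q ≥ 1, the real inequalities c · n^(p/q) ≤ e and
-- e ≤ c · n^(p/q).  All quantities are nonnegative, so raising both sides to
-- the q-th power is an equivalence, and n^(p/q) is by definition the
-- nonnegative real whose q-th power is n ^ p.
infix 4 _·_^[_/_]≤_ _≤_·_^[_/_]
_·_^[_/_]≤_ : ℚ → (n p q : ℕ) .{{_ : NonZero q}} → ℕ → Set
c · n ^[ p / q ]≤ e = (c ^ℚ q) *ℚ fromℕ (n ^ p) ≤ℚ fromℕ e ^ℚ q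

_≤_·_^[_/_] : ℕ → ℚ → (n p q : ℕ) .{{_ : NonZero q}} → Set
e ≤ c · n ^[ p / q ] = fromℕ e ^ℚ q ≤ℚ (c ^ℚ q) *ℚ fromℕ (n ^ p)

{-# OPTIONS --safe #-}

-- Upper bound.  In a {C₄, θ₃,₄}-free graph the paths x - j - i - y of length three
-- joining given x and y are internally disjoint, so there are at most three of them.
-- An edge i j whose ends have degrees exceeding a and b is the middle of at least a b
-- such paths, and the remaining edges number at most n a + m b.  Hence
-- e a b ≤ (n a + m b) a b + 3 n m, and a ≈ n^(1/9), b = a ^ 4 gives e = O(n^(10/9)).
--
-- Lower bound.  For an odd prime p, let N be an anisotropic quartic form in four
-- variables over 𝔽_p (the norm form of 𝔽_{p⁴}).  Join a line, with slope (ξ , N ξ) and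
-- intercept in 𝔽_p⁴ × 𝔽_p, to each of its p points in 𝔽_p⁶.  There are p ^ 9 lines,
-- p ^ 6 points and p ^ 10 edges.  A line and a point off it span a plane, whose slopes
-- form an affine line in 𝔽_p⁵.  This meets the graph of N in at most four points,
-- because along it N is a quartic polynomial with nonzero leading coefficient, and one
-- of the four is the slope of the given line.  So at most three paths of length three
-- join the line and the point.
--
-- A prime p with p ^ 9 ≤ n < (64 p) ^ 9 exists by Chebyshev's argument: if there is no
-- prime in (x , 16 x], then D = ∏_{i ≤ s} i ^ ⌊log_i s²⌋ · ∏_{q ≤ x} q, where s² = 16 x
-- and q runs over primes, is a common multiple of 1 , … , 16 x.  By the Leibniz triangle
-- D is then at least the central binomial coefficient (14 x choose 7 x); this fails for large x.

module Submission where

-- Chebyshev's argument: a prime between 4^j and 16 · 4^j.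

module PrimeDensity where

  open import Defs using (greatest; greatest-holds; greatest-upper)
  open import Data.Nat
  open import Data.Nat.Properties
  open import Data.Nat.Divisibility
  open import Data.Nat.Primality
  open import Data.Nat.Coprimality as Coprimality using (Coprime; coprime-divisor)
  open import Data.Nat.Induction using (<-rec)
  open import Data.Nat.Tactic.RingSolver using (solve-∀)
  open import Data.Product using (∃; _×_; _,_)
  open import Data.Sum using (inj₁; inj₂)
  open import Function using (_∘_; _$_; case_of_)
  open import Relation.Nullary using (¬_; yes; no; contradiction)
  open import Relation.Nullary.Decidable using (_×-dec_)
  open import Relation.Binary.PropositionalEquality

  -- binom i j is the binomial coefficient (i + j choose i).
  binom : ℕ → ℕ → ℕ
  binom zero    j       = 1
  binom (suc i) zero    = 1
  binom (suc i) (suc j) = binom i (suc j) + binom (suc i) j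

  binom-zeroʳ : ∀ i → binom i 0 ≡ 1
  binom-zeroʳ zero    = refl
  binom-zeroʳ (suc i) = refl

  binom-comm : ∀ i j → binom i j ≡ binom j i
  binom-comm zero    j       = sym (binom-zeroʳ j)
  binom-comm (suc i) zero    = refl
  binom-comm (suc i) (suc j) =
    trans (cong₂ _+_ (binom-comm i (suc j)) (binom-comm (suc i) j)) (+-comm (binom (suc j) i) _)

  binom≤2^ : ∀ i j → binom i j ≤ 2 ^ (i + j)
  binom≤2^ zero    j       = m^n>0 2 j
  binom≤2^ (suc i) zero    = m^n>0 2 (suc i + 0)
  binom≤2^ (suc i) (suc j) = begin
    binom i (suc j) + binom (suc i) j         ≤⟨ +-mono-≤ (binom≤2^ i (suc j)) (binom≤2^ (suc i) j) ⟩
    2 ^ (i + suc j) + 2 ^ (suc i + j)         ≡⟨ cong (λ e → 2 ^ (i + suc j) + 2 ^ e) (+-suc i j) ⟨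
    2 ^ (i + suc j) + 2 ^ (i + suc j)         ≡⟨ cong (2 ^ (i + suc j) +_) (+-identityʳ _) ⟨
    2 ^ (suc i + suc j)                       ∎
    where open ≤-Reasoning

  binom-stepʳ : ∀ i j → binom i j ≤ binom i (suc j)
  binom-stepʳ zero    j = ≤-refl
  binom-stepʳ (suc i) j = m≤n+m _ _

  binom-stepˡ : ∀ i j → binom i j ≤ binom (suc i) j
  binom-stepˡ i j = subst₂ _≤_ (binom-comm j i) (binom-comm j (suc i)) (binom-stepʳ j i)

  -- Both Pascal summands of the next central coefficient are at least the present one, so it at
  -- least doubles. This is only the square root of the true order 4 ^ n, a loss for which the
  -- factor 16 in `∃prime` leaves room.
  2^n≤binom : ∀ n → 2 ^ n ≤ binom n n
  2^n≤binom zero    = ≤-refl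
  2^n≤binom (suc n) = begin
    2 ^ n + (2 ^ n + 0)                 ≡⟨ cong (2 ^ n +_) (+-identityʳ _) ⟩
    2 ^ n + 2 ^ n                       ≤⟨ +-mono-≤ (2^n≤binom n) (2^n≤binom n) ⟩
    binom n n + binom n n               ≤⟨ +-mono-≤ (binom-stepʳ n n) (binom-stepˡ n n) ⟩
    binom n (suc n) + binom (suc n) n   ∎
    where open ≤-Reasoning

  -- Proved together with `binom-absorbʳ`: after Pascal's rule each induction step trades (i+1) ·
  -- `binom (suc i) j` for (j+1) · `binom i (suc j)`, the two being equal by both identities one
  -- step earlier. The sum then has a common factor.
  binom-absorbˡ : ∀ i j → suc i * binom (suc i) j ≡ suc (i + j) * binom i j
  binom-absorbʳ : ∀ i j → suc j * binom i (suc j) ≡ suc (i + j) * binom i j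

  binom-absorbˡ i zero = begin
    suc i * 1                 ≡⟨ cong suc (cong (_* 1) (+-identityʳ i)) ⟨
    suc (i + 0) * 1           ≡⟨ cong (suc (i + 0) *_) (binom-zeroʳ i) ⟨
    suc (i + 0) * binom i 0   ∎
    where open ≡-Reasoning
  binom-absorbˡ i (suc j) = begin
    suc i * (binom i (suc j) + binom (suc i) j)
      ≡⟨ *-distribˡ-+ (suc i) (binom i (suc j)) _ ⟩
    suc i * binom i (suc j) + suc i * binom (suc i) j
      ≡⟨ cong (suc i * binom i (suc j) +_) (trans (binom-absorbˡ i j) (sym (binom-absorbʳ i j))) ⟩
    suc i * binom i (suc j) + suc j * binom i (suc j)
      ≡⟨ *-distribʳ-+ (binom i (suc j)) (suc i) (suc j) ⟨
    suc (i + suc j) * binom i (suc j) ∎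
    where open ≡-Reasoning

  binom-absorbʳ zero    j = refl
  binom-absorbʳ (suc i) j = begin
    suc j * (binom i (suc j) + binom (suc i) j)
      ≡⟨ *-distribˡ-+ (suc j) (binom i (suc j)) _ ⟩
    suc j * binom i (suc j) + suc j * binom (suc i) j
      ≡⟨ cong (_+ suc j * binom (suc i) j) (trans (binom-absorbʳ i j) (sym (binom-absorbˡ i j))) ⟩
    suc i * binom (suc i) j + suc j * binom (suc i) j
      ≡⟨ *-distribʳ-+ (binom (suc i) j) (suc i) (suc j) ⟨
    (suc i + suc j) * binom (suc i) j
      ≡⟨ cong (_* binom (suc i) j) (cong suc (+-suc i j)) ⟩
    suc (suc i + j) * binom (suc i) j ∎
    where open ≡-Reasoning

  -- The Leibniz harmonic triangle: with a = (i+j+1) binom i j, and b, c its two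
  -- successors, 1/a = 1/b + 1/c, so a common multiple of a and b is one of c.
  leibniz : ∀ {M D} → (∀ k → 0 < k → k ≤ M → k ∣ D) →
            ∀ i j → suc (i + j) ≤ M → suc (i + j) * binom i j ∣ D
  leibniz {M} {D} div zero j h = subst (_∣ D) (sym (*-identityʳ (suc j))) (div (suc j) z<s h)
  leibniz {M} {D} div (suc i) j h
    with leibniz div i j (≤-trans (n≤1+n _) h)
       | leibniz div i (suc j) (≤-trans (s≤s (≤-reflexive (+-suc i j))) h)
  -- As u = D/a and v = D/b, the relation 1/c = 1/a - 1/b makes u - v the quotient D/c. Truncated
  -- subtraction causes no trouble, since multiplication distributes over it.
  ... | divides u D≡ua | divides v D≡vb = divides (u ∸ v) (sym (*-cancelˡ-≡ _ _ (suc i) eq))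
    where
    open ≡-Reasoning
    s = suc (i + j)
    a = s * binom i j
    b = suc (i + suc j) * binom i (suc j)
    c = suc s * binom (suc i) j
    swap3 : ∀ x y z → x * (y * z) ≡ y * (x * z)
    swap3 = solve-∀
    ci : suc i * c ≡ suc s * a
    ci = trans (swap3 (suc i) (suc s) (binom (suc i) j)) (cong (suc s *_) (binom-absorbˡ i j))
    bj : suc j * b ≡ suc s * a
    bj = trans (swap3 (suc j) (suc (i + suc j)) _) (cong₂ _*_ (cong suc (+-suc i j)) (binom-absorbʳ i j))
    cu : suc i * (u * c) ≡ suc s * D
    cu = begin
      suc i * (u * c)  ≡⟨ swap3 (suc i) u c ⟩
      u * (suc i * c)  ≡⟨ cong (u *_) ci ⟩
      u * (suc s * a)  ≡⟨ swap3 u (suc s) a ⟩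
      suc s * (u * a)  ≡⟨ cong (suc s *_) D≡ua ⟨
      suc s * D        ∎
    cv : suc i * (v * c) ≡ suc j * D
    cv = begin
      suc i * (v * c)  ≡⟨ swap3 (suc i) v c ⟩
      v * (suc i * c)  ≡⟨ cong (v *_) (trans ci (sym bj)) ⟩
      v * (suc j * b)  ≡⟨ swap3 v (suc j) b ⟩
      suc j * (v * b)  ≡⟨ cong (suc j *_) D≡vb ⟨
      suc j * D        ∎
    eq : suc i * ((u ∸ v) * c) ≡ suc i * D
    eq = begin
      suc i * ((u ∸ v) * c)                 ≡⟨ cong (suc i *_) (*-distribʳ-∸ c u v) ⟩
      suc i * (u * c ∸ v * c)               ≡⟨ *-distribˡ-∸ (suc i) (u * c) (v * c) ⟩
      suc i * (u * c) ∸ suc i * (v * c)     ≡⟨ cong₂ _∸_ cu cv ⟩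
      suc s * D ∸ suc j * D                 ≡⟨ *-distribʳ-∸ D (suc s) (suc j) ⟨
      (suc s ∸ suc j) * D                   ≡⟨ cong (λ t → (t ∸ j) * D) {x = s} {y = suc i + j} refl ⟩
      (suc i + j ∸ j) * D                   ≡⟨ cong (_* D) (m+n∸n≡m (suc i) j) ⟩
      suc i * D                             ∎

  -- If p < i + j, both Pascal summands still satisfy the hypotheses. If p = i + j, absorption shows
  -- that p divides i · `binom i j`, and p cannot divide the smaller positive number i.
  prime∣binom : ∀ {p} → Prime p → ∀ i j → i < p → j < p → p ≤ i + j → p ∣ binom i j
  prime∣binom pp zero    j       i<p j<p h = contradiction h (<⇒≱ j<p)
  prime∣binom {p} pp (suc i) zero    i<p j<p h =
    contradiction (subst (p ≤_) (+-identityʳ (suc i)) h) (<⇒≱ i<p)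
  prime∣binom {p} pp (suc i) (suc j) i<p j<p h with m≤n⇒m<n∨m≡n h
  ... | inj₁ h′ = ∣m∣n⇒∣m+n
        (prime∣binom pp i (suc j) (≤-trans (n≤1+n _) i<p) j<p (≤-pred h′))
        (prime∣binom pp (suc i) j i<p (≤-trans (n≤1+n _) j<p)
          (subst (p ≤_) (+-suc i j) (≤-pred h′)))
  ... | inj₂ p≡ with euclidsLemma (suc i) (binom (suc i) (suc j)) pp
                      (subst (p ∣_) (sym (binom-absorbˡ i (suc j)))
                        (∣m⇒∣m*n (binom i (suc j)) (∣-reflexive p≡)))
  ...   | inj₁ p∣i = contradiction (∣⇒≤ p∣i) (<⇒≱ i<p)
  ...   | inj₂ p∣b = p∣b

  -- Divisibility through prime powers.

  coprime-*-∣ : ∀ {a b c} → Coprime a b → a ∣ c → b ∣ c → a * b ∣ c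
  coprime-*-∣ {a} {b} {c} cop a∣c (divides q refl) =
    subst (a * b ∣_) (*-comm b q) (subst (_∣ b * q) (*-comm b a) (*-monoʳ-∣ b
      (coprime-divisor cop (subst (a ∣_) (*-comm q b) a∣c))))

  prime≢1 : ∀ {p} → Prime p → p ≢ 1
  prime≢1 pp refl = ¬prime[1] pp

  prime∤⇒coprime : ∀ {p n} → Prime p → ¬ p ∣ n → Coprime p n
  prime∤⇒coprime pp p∤n (d∣p , d∣n) with prime⇒irreducible pp d∣p
  ... | inj₁ d≡1  = d≡1
  ... | inj₂ refl = contradiction d∣n p∤n

  prime-^-∣ : ∀ {p q} → Prime p → Prime q → ∀ e → q ∣ p ^ e → q ≡ p
  prime-^-∣ pp qq zero    q∣1 = contradiction (∣1⇒≡1 q∣1) (prime≢1 qq)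
  prime-^-∣ {p} pp qq (suc e) q∣ with euclidsLemma p (p ^ e) qq q∣
  ... | inj₂ q∣p^e = prime-^-∣ pp qq e q∣p^e
  ... | inj₁ q∣p with prime⇒irreducible pp q∣p
  ...   | inj₁ q≡1 = contradiction q≡1 (prime≢1 qq)
  ...   | inj₂ q≡p = q≡p

  prime-factor : ∀ n → 1 < n → ∃ λ p → Prime p × p ∣ n
  prime-factor = <-rec _ go
    where
    go : ∀ n → (∀ {m} → m < n → 1 < m → ∃ λ p → Prime p × p ∣ m) → 1 < n → ∃ λ p → Prime p × p ∣ n
    go n rec 1<n with prime? n
    ... | yes pn = n , pn , ∣-refl
    ... | no ¬pn with ¬prime⇒composite {{n>1⇒nonTrivial 1<n}} ¬pn
    ...   | composite {d = d} d<n d∣n =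
            let p , pp , p∣d = rec d<n (nonTrivial⇒n>1 d) in p , pp , ∣-trans p∣d d∣n

  -- Strong induction, cancelling one prime p from B and D together. For the quotients, powers of p
  -- are handled by the hypothesis at the next exponent, and powers of another prime q by
  -- coprimality with p.
  ∣-from-prime-powers : ∀ B {D} → 0 < B → (∀ {p} e → Prime p → p ^ e ∣ B → p ^ e ∣ D) → B ∣ D
  ∣-from-prime-powers = <-rec _ go
    where
    P : ℕ → Set
    P B = ∀ {D} → 0 < B → (∀ {p} e → Prime p → p ^ e ∣ B → p ^ e ∣ D) → B ∣ D
    go : ∀ B → (∀ {B′} → B′ < B → P B′) → P B
    go B rec {D} 0<B loc with m≤n⇒m<n∨m≡n 0<B
    ... | inj₂ refl = 1∣ D
    ... | inj₁ 1<B with prime-factor B 1<B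
    ...   | p , pp , divides B′ B≡B′p
              with subst (_∣ D) (^-identityʳ p)
                     (loc 1 pp (subst (_∣ B) (sym (^-identityʳ p)) (divides B′ B≡B′p)))
    ...     | divides D′ D≡D′p =
              subst₂ _∣_ (sym B≡B′p) (sym D≡D′p) (*-monoˡ-∣ p (rec B′<B 0<B′ loc′))
      where
      instance
        p≢0 : NonZero p
        p≢0 = prime⇒nonZero pp
      0<B′ : 0 < B′
      0<B′ = case B′ ≟ 0 of λ where
        (yes refl) → contradiction (subst (0 <_) B≡B′p 0<B) λ ()
        (no B′≢0)  → n≢0⇒n>0 B′≢0
      B′<B : B′ < B
      B′<B = subst (B′ <_) (sym B≡B′p)
        (m<m*n B′ p {{>-nonZero 0<B′}} (nonTrivial⇒n>1 p {{prime⇒nonTrivial pp}}))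
      loc′ : ∀ {q} e → Prime q → q ^ e ∣ B′ → q ^ e ∣ D′
      loc′ {q} e qq q^e∣B′ with q ≟ p
      ... | yes refl = *-cancelˡ-∣ q (subst (q * q ^ e ∣_) (trans D≡D′p (*-comm D′ q))
                         (loc (suc e) qq (subst (q * q ^ e ∣_) (trans (*-comm q B′) (sym B≡B′p))
                           (*-monoʳ-∣ q q^e∣B′))))
      ... | no q≢p = coprime-divisor {n = p} (Coprimality.sym (prime∤⇒coprime pp (q≢p ∘ sym ∘ prime-^-∣ qq pp e)))
                       (subst (q ^ e ∣_) (trans D≡D′p (*-comm D′ p))
                         (loc e qq (subst (q ^ e ∣_) (sym B≡B′p) (∣m⇒∣m*n p q^e∣B′))))

  -- Products of the primes in an interval.

  primePart : ℕ → ℕ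
  primePart n with prime? n
  ... | yes _ = n
  ... | no  _ = 1

  -- The product of the primes in (a, a + j].
  primorial : ℕ → ℕ → ℕ
  primorial a zero    = 1
  primorial a (suc j) = primePart (a + suc j) * primorial a j

  primorial-+ : ∀ a i j → primorial a (i + j) ≡ primorial a i * primorial (a + i) j
  primorial-+ a i zero = trans (cong (primorial a) (+-identityʳ i)) (sym (*-identityʳ _))
  primorial-+ a i (suc j) = begin
    primorial a (i + suc j)
      ≡⟨ cong (primorial a) (+-suc i j) ⟩
    primePart (a + suc (i + j)) * primorial a (i + j)
      ≡⟨ cong₂ _*_ (cong primePart (trans (cong (a +_) (sym (+-suc i j))) (sym (+-assoc a i (suc j))))) (primorial-+ a i j) ⟩
    primePart (a + i + suc j) * (primorial a i * primorial (a + i) j)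
      ≡⟨ x∙yz≡y∙xz (primePart (a + i + suc j)) (primorial a i) _ ⟩
    primorial a i * primorial (a + i) (suc j) ∎
    where
    open ≡-Reasoning
    x∙yz≡y∙xz : ∀ x y z → x * (y * z) ≡ y * (x * z)
    x∙yz≡y∙xz = solve-∀

  prime∣primorial⇒≤ : ∀ {p} a j → Prime p → p ∣ primorial a j → p ≤ a + j
  prime∣primorial⇒≤ a zero    pp p∣1 = contradiction (∣1⇒≡1 p∣1) (prime≢1 pp)
  prime∣primorial⇒≤ a (suc j) pp p∣ with prime? (a + suc j)
  ... | no  _ = ≤-trans (prime∣primorial⇒≤ a j pp (subst (_ ∣_) (*-identityˡ _) p∣)) (+-monoʳ-≤ a (n≤1+n j))
  ... | yes q with euclidsLemma (a + suc j) (primorial a j) pp p∣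
  ...   | inj₁ p∣q = ∣⇒≤ {{prime⇒nonZero q}} p∣q
  ...   | inj₂ p∣r = ≤-trans (prime∣primorial⇒≤ a j pp p∣r) (+-monoʳ-≤ a (n≤1+n j))

  prime∣primorial : ∀ {p} a j → Prime p → a < p → p ≤ a + j → p ∣ primorial a j
  prime∣primorial a zero pp a<p p≤ = contradiction (subst (_ ≤_) (+-identityʳ a) p≤) (<⇒≱ a<p)
  prime∣primorial {p} a (suc j) pp a<p p≤ with prime? (a + suc j) | m≤n⇒m<n∨m≡n p≤
  ... | yes _ | inj₂ refl = m∣m*n _
  ... | no ¬q | inj₂ refl = contradiction pp ¬q
  ... | yes _ | inj₁ p<   = ∣n⇒∣m*n (a + suc j)
                              (prime∣primorial a j pp a<p (≤-pred (subst (p <_) (+-suc a j) p<)))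
  ... | no  _ | inj₁ p<   = ∣n⇒∣m*n 1 $ prime∣primorial a j pp a<p (≤-pred (subst (p <_) (+-suc a j) p<))

  -- Every prime in (a, 2a] divides `binom a a`. A new prime a + j + 1 exceeds all prime factors of
  -- the product so far, hence is coprime to it, and the divisors multiply.
  primorial∣binom : ∀ a j → j ≤ a → primorial a j ∣ binom a a
  primorial∣binom a zero    j≤a = 1∣ _
  primorial∣binom a (suc j) j≤a with prime? (a + suc j)
  ... | no  _ = subst (_∣ binom a a) (sym (*-identityˡ _)) (primorial∣binom a j (≤-trans (n≤1+n j) j≤a))
  ... | yes q = coprime-*-∣
        (prime∤⇒coprime q λ q∣r →
          <⇒≱ (subst (a + j <_) (sym (+-suc a j)) (n<1+n _)) (prime∣primorial⇒≤ a j q q∣r))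
        (prime∣binom q a a a<q a<q (+-monoʳ-≤ a j≤a))
        (primorial∣binom a j (≤-trans (n≤1+n j) j≤a))
    where
    a<q : a < a + suc j
    a<q = m<m+n a z<s

  binom>0 : ∀ i j → 0 < binom i j
  binom>0 zero    j       = z<s
  binom>0 (suc i) zero    = z<s
  binom>0 (suc i) (suc j) = ≤-trans (binom>0 i (suc j)) (m≤m+n _ _)

  -- Erdős's doubling: the primes up to 2n are those up to n together with those in (n, 2n], and the
  -- product of the latter divides `binom n n`, which is at most 4 ^ n.
  primorial-2^ : ∀ k → primorial 0 (2 ^ k) ≤ 2 ^ (2 * 2 ^ k)
  primorial-2^ zero    = s≤s z≤n
  primorial-2^ (suc k) = begin
    primorial 0 (n + (n + 0))                 ≡⟨ cong (primorial 0 ∘ (n +_)) (+-identityʳ n) ⟩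
    primorial 0 (n + n)                       ≡⟨ primorial-+ 0 n n ⟩
    primorial 0 n * primorial n n             ≤⟨ *-mono-≤ (primorial-2^ k) (∣⇒≤ {{>-nonZero (binom>0 n n)}} (primorial∣binom n n ≤-refl)) ⟩
    2 ^ (2 * n) * binom n n                   ≤⟨ *-monoʳ-≤ (2 ^ (2 * n)) (binom≤2^ n n) ⟩
    2 ^ (2 * n) * 2 ^ (n + n)                 ≡⟨ ^-distribˡ-+-* 2 (2 * n) (n + n) ⟨
    2 ^ (2 * n + (n + n))                     ≡⟨ cong (2 ^_) (eq n) ⟩
    2 ^ (2 * (n + (n + 0)))                   ∎
    where
    open ≤-Reasoning
    n = 2 ^ k
    eq : ∀ n → 2 * n + (n + n) ≡ 2 * (n + (n + 0))
    eq = solve-∀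

  -- Largest powers below a bound, and the contradiction from a gap without primes.

  logFloor : ℕ → ℕ → ℕ
  -- Exponents up to `M` suffice when i ≥ 2, because then e < i ^ e.
  logFloor M i = greatest (λ e → i ^ e ≤? M) M

  powerFloor : ℕ → ℕ → ℕ
  powerFloor M i = i ^ logFloor M i

  powerFloor≤ : ∀ M i → 0 < M → powerFloor M i ≤ M
  powerFloor≤ M i 0<M = greatest-holds (λ e → i ^ e ≤? M) M {0} z≤n 0<M

  n<m^n : ∀ m n → 1 < m → n < m ^ n
  n<m^n m zero    1<m = z<s
  n<m^n m (suc n) 1<m = begin-strict
    suc n       <⟨ s≤s (n<m^n m n 1<m) ⟩
    1 + m ^ n   ≤⟨ +-monoˡ-≤ (m ^ n) (m^n>0 m {{>-nonZero (<-trans z<s 1<m)}} n) ⟩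
    m ^ n + m ^ n ≡⟨ cong (m ^ n +_) (+-identityʳ (m ^ n)) ⟨
    2 * m ^ n   ≤⟨ *-monoˡ-≤ (m ^ n) 1<m ⟩
    m * m ^ n   ∎
    where open ≤-Reasoning

  ∣powerFloor : ∀ M i e → 1 < i → i ^ e ≤ M → i ^ e ∣ powerFloor M i
  ∣powerFloor M i e 1<i h = m≤n⇒m^o∣n^o e (greatest-upper (λ e → i ^ e ≤? M) M (≤-trans (<⇒≤ (n<m^n i e 1<i)) h) h)
    where
    m≤n⇒m^o∣n^o : ∀ e {f} → e ≤ f → i ^ e ∣ i ^ f
    m≤n⇒m^o∣n^o e {f} e≤f = subst (λ g → i ^ e ∣ i ^ g) (m+[n∸m]≡n e≤f)
      (subst (i ^ e ∣_) (sym (^-distribˡ-+-* i e (f ∸ e))) (m∣m*n _))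

  powerFloors : ℕ → ℕ → ℕ
  powerFloors M zero    = 1
  powerFloors M (suc s) = powerFloor M (suc s) * powerFloors M s

  powerFloors≤ : ∀ M s → 0 < M → powerFloors M s ≤ M ^ s
  powerFloors≤ M zero    0<M = ≤-refl
  powerFloors≤ M (suc s) 0<M = *-mono-≤ (powerFloor≤ M (suc s) 0<M) (powerFloors≤ M s 0<M)

  powerFloor∣powerFloors : ∀ M s i → 0 < i → i ≤ s → powerFloor M i ∣ powerFloors M s
  powerFloor∣powerFloors M zero    i 0<i i≤s = contradiction i≤s (<⇒≱ 0<i)
  powerFloor∣powerFloors M (suc s) i 0<i i≤s with m≤n⇒m<n∨m≡n i≤s
  ... | inj₂ refl = m∣m*n _
  ... | inj₁ i<   = ∣n⇒∣m*n (powerFloor M (suc s)) (powerFloor∣powerFloors M s i 0<i (≤-pred i<))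

  -- It suffices to treat prime powers dividing k. An exponent of at least two forces p ≤ s, so the
  -- power divides the factor for p in `powerFloors`. For exponent one, the absence of primes in (N
  -- , s²] gives p ≤ N, so p divides the primorial.
  common-multiple : ∀ N s → (∀ p → N < p → p ≤ s * s → ¬ Prime p) →
    ∀ k → 0 < k → k ≤ s * s → k ∣ powerFloors (s * s) s * primorial 0 N
  common-multiple N s none k 0<k k≤M = ∣-from-prime-powers k 0<k local
    where
    M = s * s
    local : ∀ {p} e → Prime p → p ^ e ∣ k → p ^ e ∣ powerFloors M s * primorial 0 N
    local zero pp _ = 1∣ _
    local {p} (suc zero) pp p∣k = ∣n⇒∣m*n (powerFloors M s) (subst (_∣ primorial 0 N) (sym (^-identityʳ p))
      (prime∣primorial 0 N pp (n≢0⇒n>0 (≢-nonZero⁻¹ p {{prime⇒nonZero pp}})) p≤N))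
      where
      p≤N : p ≤ N
      p≤N = ≮⇒≥ λ N<p → none p N<p (≤-trans (≤-reflexive (sym (^-identityʳ p))) (≤-trans (∣⇒≤ {{>-nonZero 0<k}} p∣k) k≤M)) pp
    local {p} (suc (suc e)) pp p^∣k = ∣m⇒∣m*n (primorial 0 N)
      (∣-trans (∣powerFloor M p (2 + e) 1<p p^≤M) (powerFloor∣powerFloors M s p (<-trans z<s 1<p) p≤s))
      where
      instance
        p≢0 : NonZero p
        p≢0 = prime⇒nonZero pp
      1<p : 1 < p
      1<p = nonTrivial⇒n>1 p {{prime⇒nonTrivial pp}}
      p^≤M : p ^ (2 + e) ≤ M
      p^≤M = ≤-trans (∣⇒≤ {{>-nonZero 0<k}} p^∣k) k≤M
      p≤s : p ≤ s
      p≤s = ≮⇒≥ λ s<p → <⇒≱ (*-mono-< s<p s<p) (≤-trans (*-monoʳ-≤ p (m≤m*n p (p ^ e) {{m^n≢0 p e}})) p^≤M)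

  -- The final comparison of exponents in `∃prime`, divided by 2 ^ j. It fails for every j below 4
  -- (at j = 3 both sides are 40), whence the start at 4.
  8j+16<5*2^j : ∀ i → (4 + i) * 8 + 16 < 5 * 2 ^ (4 + i)
  8j+16<5*2^j zero    = s≤s (m≤m+n 48 31)
  8j+16<5*2^j (suc i) = begin-strict
    (5 + i) * 8 + 16                  ≡⟨ eq₁ i ⟩
    (4 + i) * 8 + 16 + 8              ≤⟨ +-monoʳ-≤ ((4 + i) * 8 + 16) (m≤m+n 8 (40 + i * 8)) ⟩
    (4 + i) * 8 + 16 + (8 + (40 + i * 8)) ≡⟨ eq₂ i ⟩
    2 * ((4 + i) * 8 + 16)            <⟨ *-monoʳ-< 2 (8j+16<5*2^j i) ⟩
    2 * (5 * 2 ^ (4 + i))             ≡⟨ eq₃ (2 ^ (4 + i)) ⟩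
    5 * 2 ^ (5 + i)                   ∎
    where
    open ≤-Reasoning
    eq₁ : ∀ i → (5 + i) * 8 + 16 ≡ (4 + i) * 8 + 16 + 8
    eq₁ = solve-∀
    eq₂ : ∀ i → (4 + i) * 8 + 16 + (8 + (40 + i * 8)) ≡ 2 * ((4 + i) * 8 + 16)
    eq₂ = solve-∀
    eq₃ : ∀ x → 2 * (5 * x) ≡ 5 * (2 * x)
    eq₃ = solve-∀

  -- With N = 4 ^ j and s * s = 16 N, the absence of primes in (N , s * s] would give
  -- 2 ^ (7 N) ≤ (14 N + 1) * binom (7 N) (7 N) ≤ (s * s) ^ s * 2 ^ (2 N).
  ∃prime : ∀ j → 4 ≤ j → ∃ λ p → Prime p × 2 ^ (2 * j) < p × p ≤ 16 * 2 ^ (2 * j)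
  ∃prime j 4≤j with anyUpTo? (λ p → prime? p ×-dec (2 ^ (2 * j) <? p)) (suc (16 * 2 ^ (2 * j)))
  ... | yes (p , p< , pp , N<p) = p , pp , N<p , ≤-pred p<
  ... | no none = contradiction (^-cancelˡ-≤ 2^7N≤) (<⇒≱ exponents)
    where
    open ≤-Reasoning
    x = 2 ^ j
    N = 2 ^ (2 * j)
    s = 4 * x
    N≡ : N ≡ x * x
    N≡ = trans (cong (2 ^_) (cong (j +_) (+-identityʳ j))) (^-distribˡ-+-* 2 j j)
    ss≡ : s * s ≡ 16 * N
    ss≡ = trans (lem x) (cong (16 *_) (sym N≡))
      where
      lem : ∀ x → 4 * x * (4 * x) ≡ 16 * (x * x)
      lem = solve-∀
    N>0 : 0 < N
    N>0 = m^n>0 2 (2 * j)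
    D = powerFloors (s * s) s * primorial 0 N
    -- 7 is the largest multiplier c for which the Leibniz entry with index 2 c N + 1 stays within
    -- the range 1 , ... , 16 N of the common multiple.
    14N+1≤ : suc (7 * N + 7 * N) ≤ s * s
    14N+1≤ = begin
      1 + (7 * N + 7 * N)         ≤⟨ +-monoˡ-≤ (7 * N + 7 * N) N>0 ⟩
      N + (7 * N + 7 * N)         ≤⟨ m≤m+n _ N ⟩
      N + (7 * N + 7 * N) + N     ≡⟨ lem N ⟩
      16 * N                      ≡⟨ ss≡ ⟨
      s * s                       ∎
      where
      lem : ∀ N → N + (7 * N + 7 * N) + N ≡ 16 * N
      lem = solve-∀
    multiple : suc (7 * N + 7 * N) * binom (7 * N) (7 * N) ∣ D
    multiple = leibniz (common-multiple N s λ p N<p p≤ pp →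
      none (p , s≤s (subst (p ≤_) ss≡ p≤) , pp , N<p)) (7 * N) (7 * N) 14N+1≤
    ss≡2^ : s * s ≡ 2 ^ (4 + 2 * j)
    ss≡2^ = trans ss≡ (sym (^-distribˡ-+-* 2 4 (2 * j)))
    0<ss : 0 < s * s
    0<ss = subst (0 <_) (sym ss≡2^) (m^n>0 2 (4 + 2 * j))
    D>0 : 0 < D
    D>0 = *-mono-< (powerFloors>0 s) (primorial>0 N)
      where
      powerFloors>0 : ∀ k → 0 < powerFloors (s * s) k
      powerFloors>0 zero    = z<s
      powerFloors>0 (suc k) = *-mono-< (m^n>0 (suc k) (logFloor (s * s) (suc k))) (powerFloors>0 k)
      primorial>0 : ∀ k → 0 < primorial 0 k
      primorial>0 zero = z<s
      primorial>0 (suc k) with prime? (suc k)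
      ... | yes _ = *-mono-< {0} {suc k} z<s (primorial>0 k)
      ... | no  _ = *-mono-< {0} {1} z<s (primorial>0 k)
    2^7N≤ : 2 ^ (7 * N) ≤ 2 ^ ((4 + 2 * j) * s + 2 * N)
    2^7N≤ = begin
      2 ^ (7 * N)                                      ≤⟨ 2^n≤binom (7 * N) ⟩
      binom (7 * N) (7 * N)                            ≤⟨ m≤n*m _ (suc (7 * N + 7 * N)) ⟩
      suc (7 * N + 7 * N) * binom (7 * N) (7 * N)      ≤⟨ ∣⇒≤ {{>-nonZero D>0}} multiple ⟩
      D                                                ≤⟨ *-mono-≤ (powerFloors≤ (s * s) s 0<ss) (primorial-2^ (2 * j)) ⟩
      (s * s) ^ s * 2 ^ (2 * N)                        ≡⟨ cong (λ b → b ^ s * 2 ^ (2 * N)) ss≡2^ ⟩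
      (2 ^ (4 + 2 * j)) ^ s * 2 ^ (2 * N)              ≡⟨ cong (_* 2 ^ (2 * N)) (^-*-assoc 2 (4 + 2 * j) s) ⟩
      2 ^ ((4 + 2 * j) * s) * 2 ^ (2 * N)              ≡⟨ ^-distribˡ-+-* 2 ((4 + 2 * j) * s) (2 * N) ⟨
      2 ^ ((4 + 2 * j) * s + 2 * N)                    ∎
    ^-cancelˡ-≤ : ∀ {a b} → 2 ^ a ≤ 2 ^ b → a ≤ b
    ^-cancelˡ-≤ h = ≮⇒≥ λ b<a → <⇒≱ (^-monoʳ-< 2 ≤-refl b<a) h
    key : j * 8 + 16 < 5 * x
    key = subst (λ j → j * 8 + 16 < 5 * 2 ^ j) (m+[n∸m]≡n 4≤j) (8j+16<5*2^j (j ∸ 4))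
    exponents : (4 + 2 * j) * s + 2 * N < 7 * N
    exponents = begin-strict
      (4 + 2 * j) * (4 * x) + 2 * N     ≡⟨ cong (_+ 2 * N) (lem₁ j x) ⟩
      (j * 8 + 16) * x + 2 * N          <⟨ +-monoˡ-< (2 * N) (*-monoˡ-< x {{m^n≢0 2 j}} key) ⟩
      5 * x * x + 2 * N                 ≡⟨ cong (_+ 2 * N) (trans (*-assoc 5 x x) (cong (5 *_) (sym N≡))) ⟩
      5 * N + 2 * N                     ≡⟨ lem₂ N ⟩
      7 * N                             ∎
      where
      lem₁ : ∀ j x → (4 + 2 * j) * (4 * x) ≡ (j * 8 + 16) * x
      lem₁ = solve-∀
      lem₂ : ∀ N → 5 * N + 2 * N ≡ 7 * N
      lem₂ = solve-∀

-- The upper bound by double counting.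

module UpperBoundCounting where

  open import Defs
  open import Data.Bool using (Bool; true; false; _∧_; not)
  open import Data.Fin using (Fin; zero; suc; combine; remQuot; _↑ˡ_; _↑ʳ_; toℕ)
  open import Data.Fin.Patterns
  open import Data.Fin.Properties using (_≟_; suc-injective; remQuot-combine; combine-remQuot)
  open import Data.Fin.Subset using (Subset; ∣_∣; inside; outside)
  open import Data.Vec using ([]; _∷_; lookup)
  open import Data.Vec.Properties using (lookup⇒[]=)
  open import Data.Nat hiding (_≟_)
  open import Data.Nat.Properties hiding (_≟_; suc-injective)
  open import Data.Product using (Σ; _×_; _,_; proj₁; proj₂; uncurry)
  open import Data.Sum using (_⊎_; inj₁; inj₂)
  open import Data.Sum.Properties using (inj₁-injective; inj₂-injective)
  open import Data.Empty using (⊥)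
  open import Data.List using ([]; _∷_)
  open import Data.List.Relation.Unary.All using ([]; _∷_)
  open import Function using (_∘_; Injective)
  open import Relation.Nullary using (¬_; yes; no; contradiction; does)
  open import Relation.Binary.PropositionalEquality
  open import Algebra.Properties.Semiring.Sum +-*-semiring

  bit : Bool → ℕ
  bit true  = 1
  bit false = 0

  bit≤1 : ∀ b → bit b ≤ 1
  bit≤1 true  = ≤-refl
  bit≤1 false = z≤n

  sum-mono : ∀ {k} {f g : Fin k → ℕ} → (∀ i → f i ≤ g i) → sum f ≤ sum g
  sum-mono {zero}  h = z≤n
  sum-mono {suc k} h = +-mono-≤ (h zero) (sum-mono (h ∘ suc))

  sum-const : ∀ k c → sum {k} (λ _ → c) ≡ k * c
  sum-const zero    c = refl
  sum-const (suc k) c = cong (c +_) (sum-const k c)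

  sum-≤-const : ∀ {k} {f : Fin k → ℕ} c → (∀ i → f i ≤ c) → sum f ≤ k * c
  sum-≤-const {k} c h = ≤-trans (sum-mono h) (≤-reflexive (sum-const k c))

  sum-splits : ∀ k {l} (f : Fin (k + l) → ℕ) → sum f ≡ sum (f ∘ (_↑ˡ l)) + sum (f ∘ (k ↑ʳ_))
  sum-splits zero    f = refl
  sum-splits (suc k) {l} f =
    trans (cong (f zero +_) (sum-splits k (f ∘ suc))) (sym (+-assoc (f zero) _ _))

  sum-combine : ∀ n {m} (f : Fin (n * m) → ℕ) → sum f ≡ sum λ i → sum λ j → f (combine {n} {m} i j)
  sum-combine zero        f = refl
  sum-combine (suc n) {m} f =
    trans (sum-splits m f) (cong (sum (f ∘ (_↑ˡ (n * m))) +_) (sum-combine n (f ∘ (m ↑ʳ_))))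

  sum-remQuot : ∀ {n m} (F : Fin n → Fin m → ℕ) →
                (sum λ i → sum λ j → F i j) ≡ sum (uncurry F ∘ remQuot {n} m)
  sum-remQuot {n} {m} F = sym (trans (sum-combine n (uncurry F ∘ remQuot {n} m))
    (sum-cong-≗ λ i → sum-cong-≗ λ j → cong (uncurry F) (remQuot-combine i j)))

  sum₂-comm : ∀ {n m k l} (F : Fin n → Fin m → Fin k → Fin l → ℕ) →
              (sum λ i → sum λ j → sum λ i′ → sum λ j′ → F i j i′ j′) ≡
              (sum λ i′ → sum λ j′ → sum λ i → sum λ j → F i j i′ j′)
  sum₂-comm {n} {m} {k} {l} F = begin
    (sum λ i → sum λ j → sum λ i′ → sum λ j′ → F i j i′ j′)
      ≡⟨ sum-cong-≗ (λ i → ∑-comm λ j i′ → sum λ j′ → F i j i′ j′) ⟩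
    (sum λ i → sum λ i′ → sum λ j → sum λ j′ → F i j i′ j′)
      ≡⟨ ∑-comm (λ i i′ → sum λ j → sum λ j′ → F i j i′ j′) ⟩
    (sum λ i′ → sum λ i → sum λ j → sum λ j′ → F i j i′ j′)
      ≡⟨ sum-cong-≗ (λ i′ → sum-cong-≗ λ i → ∑-comm λ j j′ → F i j i′ j′) ⟩
    (sum λ i′ → sum λ i → sum λ j′ → sum λ j → F i j i′ j′)
      ≡⟨ sum-cong-≗ (λ i′ → ∑-comm λ i j′ → sum λ j → F i j i′ j′) ⟩
    (sum λ i′ → sum λ j′ → sum λ i → sum λ j → F i j i′ j′) ∎
    where open ≡-Reasoning

  ∣p∣≡sum : ∀ {k} (p : Subset k) → ∣ p ∣ ≡ sum (bit ∘ lookup p)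
  ∣p∣≡sum []            = refl
  ∣p∣≡sum (inside ∷ p)  = cong suc (∣p∣≡sum p)
  ∣p∣≡sum (outside ∷ p) = ∣p∣≡sum p

  sum-bit-≟ : ∀ {k} (i : Fin k) → sum (λ j → bit (does (i ≟ j))) ≡ 1
  sum-bit-≟ {suc k} zero    = cong suc (trans (sum-const k 0) (*-zeroʳ k))
  sum-bit-≟ {suc k} (suc i) = sum-bit-≟ i

  -- Turns a lower bound on a count into distinct indices; this is how four counted paths become an
  -- embedded theta graph.
  choose : ∀ {k} t (b : Fin k → Bool) → t ≤ sum (bit ∘ b) →
           Σ (Fin t → Fin k) λ g → Injective _≡_ _≡_ g × (∀ i → b (g i) ≡ true)
  choose {zero} zero b h = (λ ()) , (λ { {()} }) , λ ()
  choose {suc k} t b h with b zero in b₀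
  choose {suc k} t b h | false with choose t (b ∘ suc) h
  ... | g , inj , ok = suc ∘ g , inj ∘ suc-injective , ok
  choose {suc k} zero b h | true = (λ ()) , (λ { {()} }) , λ ()
  choose {suc k} (suc t) b h | true with choose t (b ∘ suc) (≤-pred h)
  ... | g , inj , ok = g′ , inj′ , ok′
    where
    g′ : Fin (suc t) → Fin (suc k)
    g′ zero    = zero
    g′ (suc i) = suc (g i)
    inj′ : Injective _≡_ _≡_ g′
    inj′ {zero}  {zero}  _  = refl
    inj′ {suc i} {suc j} eq = cong suc (inj (suc-injective eq))
    ok′ : ∀ i → b (g′ i) ≡ true
    ok′ zero    = b₀
    ok′ (suc i) = ok i

  ∧-true : ∀ {x y} → x ∧ y ≡ true → x ≡ true × y ≡ true
  ∧-true {true} {true} _ = refl , refl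

  not-≟-true : ∀ {k} (i j : Fin k) → not (does (i ≟ j)) ≡ true → i ≢ j
  not-≟-true i j h with i ≟ j
  ... | no i≢j = i≢j

  bit-∧ : ∀ x y → bit (x ∧ y) ≡ bit x * bit y
  bit-∧ true  y = sym (+-identityʳ _)
  bit-∧ false y = refl

  -- Paths of length three in a graph without C₄ and θ₃,₄.

  module UpperBound {n m : ℕ} (E : BipartiteEdges n m)
    (¬C₄ : ¬ (Cycle 4 ⊑ bipartite n m E)) (¬θ : ¬ (Theta 3 4 ⊑ bipartite n m E)) where

    open Graph (bipartite n m E) using (_∼_; ∼-sym)

    A : Fin n → Fin m → Bool
    A i j = lookup E (combine i j)

    edge : ∀ {i j} → A i j ≡ true → inj₁ i ∼ inj₂ j
    edge h = (λ ()) , inj₁ (lookup⇒[]= _ _ h)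

    no-C₄ : ∀ {i i′ j j′} → i ≢ i′ → j ≢ j′ →
            A i j ≡ true → A i′ j ≡ true → A i′ j′ ≡ true → ¬ A i j′ ≡ true
    no-C₄ {i} {i′} {j} {j′} i≢i′ j≢j′ ij i′j i′j′ ij′ = ¬C₄ (f , (λ {x} {y} → inj x y) , λ {x} {y} → hom x y)
      where
      f : Fin 4 → Fin n ⊎ Fin m
      f 0F = inj₁ i
      f 1F = inj₂ j
      f 2F = inj₁ i′
      f 3F = inj₂ j′
      inj : ∀ x y → f x ≡ f y → x ≡ y
      inj 0F 0F _    = refl
      inj 0F 2F refl = contradiction refl i≢i′
      inj 0F 3F ()
      inj 1F 1F _    = refl
      inj 1F 3F refl = contradiction refl j≢j′
      inj 2F 0F refl = contradiction refl i≢i′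
      inj 2F 2F _    = refl
      inj 2F 3F ()
      inj 3F 1F refl = contradiction refl j≢j′
      inj 3F 3F _    = refl
      step : ∀ x y → toℕ y ≡ suc (toℕ x) % 4 → f x ∼ f y
      step 0F 1F _ = edge ij
      step 1F 2F _ = ∼-sym {inj₁ i′} {inj₂ j} (edge i′j)
      step 2F 3F _ = edge i′j′
      step 3F 0F _ = ∼-sym {inj₁ i} {inj₂ j′} (edge ij′)
      step 0F 0F ()
      step 0F 2F ()
      step 0F 3F ()
      step 1F 0F ()
      step 1F 1F ()
      step 1F 3F ()
      step 2F 0F ()
      step 2F 1F ()
      step 2F 2F ()
      step 3F 1F ()
      step 3F 2F ()
      step 3F 3F ()
      hom : ∀ x y → Graph._∼_ (Cycle 4) x y → f x ∼ f y
      hom x y (_ , inj₁ s) = step x y s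
      hom x y (_ , inj₂ s) = ∼-sym {f y} {f x} (step y x s)

    -- The middle edges are only assumed distinct as pairs; the absence of C₄ makes the paths
    -- internally disjoint. Two of them sharing x₁ but not y₁ would give a 4-cycle through x and x₁,
    -- and sharing y₁ but not x₁ one through y and y₁.
    no-θ : ∀ x y (x₁ : Fin 4 → Fin n) (y₁ : Fin 4 → Fin m) →
           (∀ p → x₁ p ≢ x) → (∀ p → y₁ p ≢ y) →
           (∀ p → A x (y₁ p) ≡ true) → (∀ p → A (x₁ p) (y₁ p) ≡ true) → (∀ p → A (x₁ p) y ≡ true) →
           (∀ {p q} → (x₁ p , y₁ p) ≡ (x₁ q , y₁ q) → p ≡ q) → ⊥
    no-θ x y x₁ y₁ x₁≢x y₁≢y xy₁ x₁y₁ x₁y distinct = ¬θ (f , (λ {u} {v} → inj u v) , λ {u} {v} → hom u v)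
      where
      x₁-inj : ∀ {p q} → x₁ p ≡ x₁ q → p ≡ q
      x₁-inj {p} {q} eq with y₁ p ≟ y₁ q
      ... | yes eq′ = distinct (cong₂ _,_ eq eq′)
      ... | no  neq = contradiction (xy₁ q)
            (no-C₄ (x₁≢x p ∘ sym) neq (xy₁ p) (x₁y₁ p) (subst (λ z → A z (y₁ q) ≡ true) (sym eq) (x₁y₁ q)))
      y₁-inj : ∀ {p q} → y₁ p ≡ y₁ q → p ≡ q
      y₁-inj {p} {q} eq with x₁ p ≟ x₁ q
      ... | yes eq′ = distinct (cong₂ _,_ eq′ eq)
      ... | no  neq = contradiction (x₁y p)
            (no-C₄ neq (y₁≢y p) (x₁y₁ p) (subst (λ z → A (x₁ q) z ≡ true) (sym eq) (x₁y₁ q)) (x₁y q))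
      f : ThetaVertex 3 4 → Fin n ⊎ Fin m
      f source       = inj₁ x
      f target       = inj₂ y
      f (inner p 0F) = inj₂ (y₁ p)
      f (inner p 1F) = inj₁ (x₁ p)
      inj : ∀ u v → f u ≡ f v → u ≡ v
      inj source source _ = refl
      inj source (inner p 1F) eq = contradiction (sym (inj₁-injective eq)) (x₁≢x p)
      inj source target ()
      inj target target _ = refl
      inj target (inner p 1F) ()
      inj (inner p 0F) (inner q 1F) ()
      inj (inner p 1F) target ()
      inj target (inner p 0F) eq = contradiction (sym (inj₂-injective eq)) (y₁≢y p)
      inj (inner p 0F) target eq = contradiction (inj₂-injective eq) (y₁≢y p)
      inj (inner p 0F) (inner q 0F) eq = cong (λ r → inner r 0F) (y₁-inj (inj₂-injective eq))
      inj (inner p 1F) source eq = contradiction (inj₁-injective eq) (x₁≢x p)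
      inj (inner p 1F) (inner q 1F) eq = cong (λ r → inner r 1F) (x₁-inj (inj₁-injective eq))
      step : ∀ u v → ThetaStep 3 4 u v → f u ∼ f v
      step source (inner p 0F) _ = edge (xy₁ p)
      step (inner p 0F) (inner q 1F) (refl , _) = ∼-sym {inj₁ (x₁ p)} {inj₂ (y₁ p)} (edge (x₁y₁ p))
      step (inner p 1F) target _ = edge (x₁y p)
      step source source ()
      step source target ()
      step target _ ()
      step source (inner p 1F) ()
      step (inner p 0F) source ()
      step (inner p 0F) target ()
      step (inner p 0F) (inner q 0F) (_ , ())
      step (inner p 1F) (inner q 0F) (_ , ())
      step (inner p 1F) (inner q 1F) (_ , ())
      hom : ∀ u v → Graph._∼_ (Theta 3 4) u v → f u ∼ f v
      hom u v (_ , inj₁ s) = step u v s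
      hom u v (_ , inj₂ s) = ∼-sym {f v} {f u} (step v u s)

    -- Whether x - j - i - y is a path of length three.
    isPath : Fin n → Fin m → Fin n → Fin m → Bool
    isPath x y i j = A i j ∧ ((not (does (i ≟ x)) ∧ A x j) ∧ (not (does (j ≟ y)) ∧ A i y))

    paths≤3 : ∀ x y → (sum λ i → sum λ j → bit (isPath x y i j)) ≤ 3
    paths≤3 x y = ≮⇒≥ λ 3< →
      let g , inj , ok = choose 4 (uncurry (isPath x y) ∘ remQuot {n} m)
                           (≤-trans 3< (≤-reflexive (sum-remQuot λ i j → bit (isPath x y i j))))
          x₁ = proj₁ ∘ remQuot {n} m ∘ g
          y₁ = proj₂ ∘ remQuot {n} m ∘ g
          ij = λ p → proj₁ (∧-true (ok p))
          l  = λ p → ∧-true (proj₁ (∧-true (proj₂ (∧-true {A (x₁ p) (y₁ p)} (ok p)))))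
          r  = λ p → ∧-true (proj₂ (∧-true {not (does (x₁ p ≟ x)) ∧ A x (y₁ p)} (proj₂ (∧-true {A (x₁ p) (y₁ p)} (ok p)))))
      in no-θ x y x₁ y₁
           (λ p → not-≟-true (x₁ p) x (proj₁ (l p))) (λ p → not-≟-true (y₁ p) y (proj₁ (r p)))
           (λ p → proj₂ (l p)) ij (λ p → proj₂ (r p))
           (λ {p} {q} eq → inj (trans (sym (combine-remQuot {n} m (g p)))
                                 (trans (cong (uncurry combine) eq) (combine-remQuot {n} m (g q)))))

    dX : Fin n → ℕ
    dX i = sum λ j → bit (A i j)

    dY : Fin m → ℕ
    dY j = sum λ i → bit (A i j)

    -- The number of ways to prolong the middle edge i j beyond i; on an edge this is the degree of
    -- i minus one.
    dX⁻ : Fin n → Fin m → ℕ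
    dX⁻ i j = sum λ y → bit (not (does (j ≟ y)) ∧ A i y)

    dY⁻ : Fin n → Fin m → ℕ
    dY⁻ i j = sum λ x → bit (not (does (i ≟ x)) ∧ A x j)

    private
      bit-split : ∀ b c → bit c ≤ bit b + bit (not b ∧ c)
      bit-split true  c = ≤-trans (bit≤1 c) (m≤m+n 1 _)
      bit-split false c = ≤-refl

      degree-drop : ∀ {k} (i : Fin k) (c : Fin k → Bool) →
        sum (λ x → bit (c x)) ≤ suc (sum λ x → bit (not (does (i ≟ x)) ∧ c x))
      degree-drop i c = begin
        sum (λ x → bit (c x))
          ≤⟨ sum-mono (λ x → bit-split (does (i ≟ x)) (c x)) ⟩
        sum (λ x → bit (does (i ≟ x)) + bit (not (does (i ≟ x)) ∧ c x))
          ≡⟨ ∑-distrib-+ (λ x → bit (does (i ≟ x))) (λ x → bit (not (does (i ≟ x)) ∧ c x)) ⟩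
        sum (λ x → bit (does (i ≟ x))) + sum (λ x → bit (not (does (i ≟ x)) ∧ c x))
          ≡⟨ cong (_+ sum (λ x → bit (not (does (i ≟ x)) ∧ c x))) (sum-bit-≟ i) ⟩
        suc (sum λ x → bit (not (does (i ≟ x)) ∧ c x)) ∎
        where open ≤-Reasoning

    -- For a fixed middle edge the two ends are chosen independently, so the double sum factors.
    paths-through : ∀ i j → (sum λ x → sum λ y → bit (isPath x y i j)) ≡ bit (A i j) * (dY⁻ i j * dX⁻ i j)
    paths-through i j = begin
      (sum λ x → sum λ y → bit (isPath x y i j))
        ≡⟨ sum-cong-≗ (λ x → sum-cong-≗ λ y → trans (bit-∧ (A i j) (l x ∧ r y)) (cong (bit (A i j) *_) (bit-∧ (l x) (r y)))) ⟩
      (sum λ x → sum λ y → bit (A i j) * (bit (l x) * bit (r y)))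
        ≡⟨ sum-cong-≗ (λ x → trans (sym (*-distribˡ-sum (bit (A i j)) λ y → bit (l x) * bit (r y)))
             (cong (bit (A i j) *_) (sym (*-distribˡ-sum (bit (l x)) (bit ∘ r))))) ⟩
      (sum λ x → bit (A i j) * (bit (l x) * dX⁻ i j))
        ≡⟨ *-distribˡ-sum (bit (A i j)) (λ x → bit (l x) * dX⁻ i j) ⟨
      bit (A i j) * (sum λ x → bit (l x) * dX⁻ i j)
        ≡⟨ cong (bit (A i j) *_) (*-distribʳ-sum (dX⁻ i j) (bit ∘ l)) ⟨
      bit (A i j) * (dY⁻ i j * dX⁻ i j) ∎
      where
      open ≡-Reasoning
      l : Fin n → Bool
      l x = not (does (i ≟ x)) ∧ A x j
      r : Fin m → Bool
      r y = not (does (j ≟ y)) ∧ A i y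

    -- Count the paths by their ends instead of their middle edges: each of the n m pairs of ends
    -- admits at most three.
    total-paths : (sum λ i → sum λ j → bit (A i j) * (dY⁻ i j * dX⁻ i j)) ≤ n * (m * 3)
    total-paths = begin
      (sum λ i → sum λ j → bit (A i j) * (dY⁻ i j * dX⁻ i j))
        ≡⟨ sum-cong-≗ (λ i → sum-cong-≗ λ j → paths-through i j) ⟨
      (sum λ i → sum λ j → sum λ x → sum λ y → bit (isPath x y i j))
        ≡⟨ sum₂-comm (λ i j x y → bit (isPath x y i j)) ⟩
      (sum λ x → sum λ y → sum λ i → sum λ j → bit (isPath x y i j))
        ≤⟨ sum-≤-const (m * 3) (λ x → sum-≤-const 3 (paths≤3 x)) ⟩
      n * (m * 3) ∎
      where open ≤-Reasoning

    low : ℕ → ℕ → ℕ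
    low t d with d ≤? t
    ... | yes _ = 1
    ... | no  _ = 0

    low-≤ : ∀ t d → d * low t d ≤ t
    low-≤ t d with d ≤? t
    ... | yes d≤t = ≤-trans (≤-reflexive (*-identityʳ d)) d≤t
    ... | no  _   = ≤-trans (≤-reflexive (*-zeroʳ d)) z≤n

    -- The edges at a vertex of low degree are few; every other edge is the
    -- middle edge of at least a * b paths.
    edge-split : ∀ a b i j → bit (A i j) * (a * b) ≤
      bit (A i j) * low a (dX i) * (a * b) + bit (A i j) * low b (dY j) * (a * b) + bit (A i j) * (dY⁻ i j * dX⁻ i j)
    edge-split a b i j with A i j
    ... | false = z≤n
    ... | true with dX i ≤? a | dY j ≤? b
    ...   | yes _ | _     = ≤-trans (m≤m+n (1 * (a * b)) _) (m≤m+n _ _)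
    ...   | no  _ | yes _ = ≤-trans (m≤n+m (1 * (a * b)) 0) (m≤m+n _ _)
    -- Degrees above a and b are at least a + 1 and b + 1, so after removing the edge itself at
    -- least a and b prolongations remain.
    ...   | no x  | no y  = *-monoʳ-≤ 1 (≤-trans (≤-reflexive (*-comm a b)) (*-mono-≤
            (≤-pred (≤-trans (≰⇒> y) (degree-drop i λ x → A x j)))
            (≤-pred (≤-trans (≰⇒> x) (degree-drop j (A i))))))

    -- Sum `edge-split` over all pairs. Low vertices of the two parts carry at most n a and m b
    -- edges, and the last term is `total-paths`. The factor a b is kept on both sides in place of a
    -- division.
    edges-bound : ∀ a b → ∣ E ∣ * (a * b) ≤ n * (a * (a * b)) + m * (b * (a * b)) + n * (m * 3)
    edges-bound a b = begin
      ∣ E ∣ * (a * b)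
        ≡⟨ cong (_* (a * b)) (trans (∣p∣≡sum E) (sum-combine n (bit ∘ lookup E))) ⟩
      (sum λ i → sum λ j → bit (A i j)) * (a * b)
        ≡⟨ trans (*-distribʳ-sum (a * b) (λ i → sum λ j → bit (A i j)))
             (sum-cong-≗ λ i → *-distribʳ-sum (a * b) λ j → bit (A i j)) ⟩
      (sum λ i → sum λ j → bit (A i j) * (a * b))
        ≤⟨ sum-mono (λ i → sum-mono λ j → edge-split a b i j) ⟩
      (sum λ i → sum λ j → X i j + Y i j + Z i j)
        ≡⟨ sum-cong-≗ (λ i → trans (∑-distrib-+ (λ j → X i j + Y i j) (Z i)) (cong (_+ sum (Z i)) (∑-distrib-+ (X i) (Y i)))) ⟩
      (sum λ i → sum (X i) + sum (Y i) + sum (Z i))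
        ≡⟨ trans (∑-distrib-+ (λ i → sum (X i) + sum (Y i)) (λ i → sum (Z i)))
             (cong (_+ sum (λ i → sum (Z i))) (∑-distrib-+ (λ i → sum (X i)) (λ i → sum (Y i)))) ⟩
      (sum λ i → sum (X i)) + (sum λ i → sum (Y i)) + (sum λ i → sum (Z i))
        ≤⟨ +-mono-≤ (+-mono-≤ ΣX ΣY) total-paths ⟩
      n * (a * (a * b)) + m * (b * (a * b)) + n * (m * 3) ∎
      where
      open ≤-Reasoning
      X Y Z : Fin n → Fin m → ℕ
      X i j = bit (A i j) * low a (dX i) * (a * b)
      Y i j = bit (A i j) * low b (dY j) * (a * b)
      Z i j = bit (A i j) * (dY⁻ i j * dX⁻ i j)
      collect : ∀ {k} (f : Fin k → ℕ) t c → (sum λ j → f j * low t (sum f) * c) ≤ t * c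
      collect f t c = begin
        (sum λ j → f j * low t (sum f) * c)   ≡⟨ *-distribʳ-sum c (λ j → f j * low t (sum f)) ⟨
        (sum λ j → f j * low t (sum f)) * c   ≡⟨ cong (_* c) (*-distribʳ-sum (low t (sum f)) f) ⟨
        sum f * low t (sum f) * c             ≤⟨ *-monoˡ-≤ c (low-≤ t (sum f)) ⟩
        t * c                                 ∎
      ΣX : (sum λ i → sum (X i)) ≤ n * (a * (a * b))
      ΣX = sum-≤-const _ λ i → collect (bit ∘ A i) a (a * b)
      ΣY : (sum λ i → sum (Y i)) ≤ m * (b * (a * b))
      ΣY = ≤-trans (≤-reflexive (∑-comm Y)) (sum-≤-const _ λ j → collect (λ i → bit (A i j)) b (a * b))

-- Affine lines over 𝔽_p with slopes on the graph of a norm form.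

module AffineLines where

  open import Data.Nat as ℕ using (ℕ; zero; suc)
  import Data.Nat.Properties as ℕ
  import Data.Nat.Divisibility as ℕ
  open import Data.Nat.Primality using (Prime; prime⇒nonZero; euclidsLemma; prime⇒irreducible)
  import Data.Nat.Coprimality as Coprimality
  open import Data.Nat.GCD using (module Bézout)
  open import Data.Integer using (ℤ; +_; -[1+_]; ∣_∣; _+_; _*_; _-_; -_; 0ℤ; 1ℤ)
  open import Data.Integer.Properties using (+-inverseʳ; +-identityʳ; abs-*; pos-*; +-injective; i-j≡0⇒i≡j; ∣i∣≡0⇒i≡0; m-n≡m⊖n; ∣m⊝n∣≤m⊔n)
  open import Data.Integer.DivMod using (_%ℕ_; _/ℕ_; n%ℕd<d; a≡a%ℕn+[a/ℕn]*n)
  open import Data.Integer.Divisibility.Signed using (_∣_; divides; _∣?_; ∣m∣n⇒∣m+n; ∣n⇒∣m*n; ∣⇒∣ᵤ; ∣ᵤ⇒∣)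
  open import Data.Integer.Tactic.RingSolver using (solve-∀)
  open import Data.Fin as Fin using (Fin; zero; suc; toℕ; fromℕ<; combine; remQuot; punchOut)
  open import Data.Fin.Patterns
  open import Data.Fin.Properties as Fin using (any?; all?; punchOut-injective; injective⇒≤; toℕ-injective; toℕ-fromℕ<; toℕ<n)
  open import Data.Vec using (Vec; []; _∷_)
  open import Data.Vec.Relation.Unary.All as All using (All; []; _∷_)
  open import Data.Product using (Σ; ∃; ∃₂; _×_; _,_; proj₁; proj₂)
  open import Data.Sum using (_⊎_; inj₁; inj₂; [_,_]′)
  open import Function using (_∘_; Injective)
  open import Relation.Nullary using (¬_; Dec; yes; no; contradiction; ¬?)
  open import Relation.Nullary.Decidable using (map′)
  open import Relation.Binary.PropositionalEquality

  -- If f were onto, every value would have a preimage other than i, with j standing in for i.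
  -- Choosing such preimages would inject k elements into k - 1. Applied to squaring, with the
  -- collision of 1 and -1, it yields nonsquares.
  collision⇒not-surjective : ∀ {k} (f : Fin k → Fin k) {i j} → i ≢ j → f i ≡ f j →
                             ∃ λ c → ∀ x → f x ≢ c
  collision⇒not-surjective {suc k} f {i} {j} i≢j fi≡fj with any? (λ c → all? λ x → ¬? (f x Fin.≟ c))
  ... | yes found = found
  ... | no  none  = contradiction (injective⇒≤ h-injective) (ℕ.<⇒≱ ℕ.≤-refl)
    where
    preimage : ∀ c → ∃ λ x → f x ≡ c
    preimage c with any? (λ x → f x Fin.≟ c)
    ... | yes hit = hit
    ... | no miss = contradiction (c , λ x eq → miss (x , eq)) none
    preimage≢i : ∀ c → ∃ λ x → i ≢ x × f x ≡ c
    preimage≢i c with preimage c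
    ... | x , fx≡c with i Fin.≟ x
    ...   | no i≢x   = x , i≢x , fx≡c
    ...   | yes refl = j , i≢j , trans (sym fi≡fj) fx≡c
    h : Fin (suc k) → Fin k
    h c = punchOut (proj₁ (proj₂ (preimage≢i c)))
    h-injective : Injective _≡_ _≡_ h
    h-injective {c} {c′} eq = trans (sym (proj₂ (proj₂ (preimage≢i c))))
      (trans (cong f (punchOut-injective (proj₁ (proj₂ (preimage≢i c))) (proj₁ (proj₂ (preimage≢i c′))) eq)) (proj₂ (proj₂ (preimage≢i c′))))

  -- Arithmetic modulo a prime.

  module Congruence (p : ℕ) (pp : Prime p) where

    private instance
      p≢0 : ℕ.NonZero p
      p≢0 = prime⇒nonZero pp

    infix 4 _≈_ _≉_ _≈?_
    -- Elements of 𝔽_p are represented by integers, so that polynomial identities can be solved over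
    -- ℤ. A record, unlike a synonym for `+ p ∣ x - y`, lets unification recover the two sides.
    record _≈_ (x y : ℤ) : Set where
      constructor mod
      field divides-difference : + p ∣ x - y
    open _≈_

    _≉_ : ℤ → ℤ → Set
    x ≉ y = ¬ x ≈ y

    abstract
      _≈?_ : ∀ x y → Dec (x ≈ y)
      x ≈? y = map′ mod divides-difference (+ p ∣? (x - y))

      -- The standard way to derive congruences below: write the difference of the goal as an
      -- integer combination of differences known to vanish, and leave that identity to the ring
      -- solver.
      ≈-by : ∀ {x y a b} k → x - y ≡ k * (a - b) → a ≈ b → x ≈ y
      ≈-by k eq (mod d) = mod (subst (+ p ∣_) (sym eq) (∣n⇒∣m*n k d))

      ≈-by₂ : ∀ {x y a b c d} k l → x - y ≡ k * (a - b) + l * (c - d) → a ≈ b → c ≈ d → x ≈ y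
      ≈-by₂ k l eq (mod d) (mod e) = mod (subst (+ p ∣_) (sym eq) (∣m∣n⇒∣m+n (∣n⇒∣m*n k d) (∣n⇒∣m*n l e)))

      ≈-reflexive : ∀ {x y} → x ≡ y → x ≈ y
      ≈-reflexive {x} refl = mod (divides 0ℤ (+-inverseʳ x))

      ≈-refl : ∀ {x} → x ≈ x
      ≈-refl = ≈-reflexive refl

      ≈-sym : ∀ {x y} → x ≈ y → y ≈ x
      ≈-sym {x} {y} = ≈-by (- 1ℤ) (lem x y)
        where
        lem : ∀ x y → y - x ≡ - 1ℤ * (x - y)
        lem = solve-∀

      ≈-trans : ∀ {x y z} → x ≈ y → y ≈ z → x ≈ z
      ≈-trans {x} {y} {z} = ≈-by₂ 1ℤ 1ℤ (lem x y z)
        where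
        lem : ∀ x y z → x - z ≡ 1ℤ * (x - y) + 1ℤ * (y - z)
        lem = solve-∀

      +-cong : ∀ {x x′ y y′} → x ≈ x′ → y ≈ y′ → x + y ≈ x′ + y′
      +-cong {x} {x′} {y} {y′} = ≈-by₂ 1ℤ 1ℤ (lem x x′ y y′)
        where
        lem : ∀ x x′ y y′ → x + y - (x′ + y′) ≡ 1ℤ * (x - x′) + 1ℤ * (y - y′)
        lem = solve-∀

      neg-cong : ∀ {x x′} → x ≈ x′ → - x ≈ - x′
      neg-cong {x} {x′} = ≈-by (- 1ℤ) (lem x x′)
        where
        lem : ∀ x x′ → - x - (- x′) ≡ - 1ℤ * (x - x′)
        lem = solve-∀

      -‿cong : ∀ {x x′ y y′} → x ≈ x′ → y ≈ y′ → x - y ≈ x′ - y′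
      -‿cong e f = +-cong e (neg-cong f)

      *-congr : ∀ {x x′ y y′} → x ≈ x′ → y ≈ y′ → x * y ≈ x′ * y′
      *-congr {x} {x′} {y} {y′} = ≈-by₂ y x′ (lem x x′ y y′)
        where
        lem : ∀ x x′ y y′ → x * y - x′ * y′ ≡ y * (x - x′) + x′ * (y - y′)
        lem = solve-∀

      difference≈0 : ∀ {x y} → x ≈ y → x - y ≈ 0ℤ
      difference≈0 {x} {y} = ≈-by 1ℤ (lem x y)
        where
        lem : ∀ x y → x - y - 0ℤ ≡ 1ℤ * (x - y)
        lem = solve-∀

      difference≈0⁻ : ∀ {x y} → x - y ≈ 0ℤ → x ≈ y
      difference≈0⁻ {x} {y} = ≈-by 1ℤ (lem x y)
        where
        lem : ∀ x y → x - y ≡ 1ℤ * (x - y - 0ℤ)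
        lem = solve-∀

      *-zero : ∀ {x y} → x * y ≈ 0ℤ → x ≈ 0ℤ ⊎ y ≈ 0ℤ
      *-zero {x} {y} (mod d) with euclidsLemma ∣ x ∣ ∣ y ∣ pp
          (subst (p ℕ.∣_) (trans (cong ∣_∣ (+-identityʳ (x * y))) (abs-* x y)) (∣⇒∣ᵤ d))
      ... | inj₁ p∣x = inj₁ (mod (subst (+ p ∣_) (sym (+-identityʳ x)) (∣ᵤ⇒∣ p∣x)))
      ... | inj₂ p∣y = inj₂ (mod (subst (+ p ∣_) (sym (+-identityʳ y)) (∣ᵤ⇒∣ p∣y)))

      square-zero : ∀ {x} → x * x ≈ 0ℤ → x ≈ 0ℤ
      square-zero h with *-zero h
      ... | inj₁ z = z
      ... | inj₂ z = z

      *-cancel : ∀ {k x y} → k ≉ 0ℤ → k * x ≈ k * y → x ≈ y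
      *-cancel {k} {x} {y} k≉0 h with *-zero (≈-by 1ℤ (lem k x y) h)
        where
        lem : ∀ k x y → k * (x - y) - 0ℤ ≡ 1ℤ * (k * x - k * y)
        lem = solve-∀
      ... | inj₁ k≈0 = contradiction k≈0 k≉0
      ... | inj₂ x≈y = difference≈0⁻ x≈y

      -- Bézout gives u · |x| ≈ ±1. Squaring removes both the sign and the absolute value, so x · u²
      -- is an inverse of x.
      *-inverse : ∀ {x} → x ≉ 0ℤ → ∃ λ y → x * y ≈ 1ℤ
      *-inverse {x} x≉0 = [ (λ (u , h) → x * (+ u * + u) , ≈-trans (≈-reflexive (square (+ u))) (*-congr h h))
                          , (λ (u , h) → x * (+ u * + u) , ≈-trans (≈-reflexive (square (+ u))) (*-congr h h)) ]′ bézout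
        where
        coprime : Coprimality.Coprime ∣ x ∣ p
        coprime {d} (d∣x , d∣p) with prime⇒irreducible pp d∣p
        ... | inj₁ d≡1  = d≡1
        ... | inj₂ refl = contradiction (mod (subst (+ p ∣_) (sym (+-identityʳ x)) (∣ᵤ⇒∣ d∣x))) x≉0
        abs-square : ∀ x → x * x ≡ + ∣ x ∣ * + ∣ x ∣
        abs-square (+ n)    = refl
        abs-square -[1+ n ] = refl
        square : ∀ u → x * (x * (u * u)) ≡ (u * + ∣ x ∣) * (u * + ∣ x ∣)
        square u = trans (lem₁ x u) (trans (cong (u * u *_) (abs-square x)) (lem₂ u (+ ∣ x ∣)))
          where
          lem₁ : ∀ x u → x * (x * (u * u)) ≡ u * u * (x * x)
          lem₁ = solve-∀
          lem₂ : ∀ u y → u * u * (y * y) ≡ u * y * (u * y)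
          lem₂ = solve-∀
        bézout : (∃ λ u → + u * + ∣ x ∣ ≈ 1ℤ) ⊎ (∃ λ u → + u * + ∣ x ∣ ≈ - 1ℤ)
        bézout with Coprimality.coprime-Bézout coprime
        ... | Bézout.+- u v eq = inj₁ (u , mod (divides (+ v) (begin
          + u * + ∣ x ∣ - 1ℤ        ≡⟨ cong (_- 1ℤ) (pos-* u ∣ x ∣) ⟨
          + (u ℕ.* ∣ x ∣) - 1ℤ      ≡⟨ cong (λ z → + z - 1ℤ) eq ⟨
          + (1 ℕ.+ v ℕ.* p) - 1ℤ    ≡⟨ cong (λ z → 1ℤ + z - 1ℤ) (pos-* v p) ⟩
          1ℤ + + v * + p - 1ℤ       ≡⟨ lem (+ v * + p) ⟩
          + v * + p                 ∎)))
          where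
          open ≡-Reasoning
          lem : ∀ z → 1ℤ + z - 1ℤ ≡ z
          lem = solve-∀
        ... | Bézout.-+ u v eq = inj₂ (u , mod (divides (+ v) (begin
          + u * + ∣ x ∣ - - 1ℤ      ≡⟨ lem (+ u * + ∣ x ∣) ⟩
          1ℤ + + u * + ∣ x ∣        ≡⟨ cong (λ z → 1ℤ + z) (pos-* u ∣ x ∣) ⟨
          + (1 ℕ.+ u ℕ.* ∣ x ∣)     ≡⟨ cong +_ eq ⟩
          + (v ℕ.* p)               ≡⟨ pos-* v p ⟩
          + v * + p                 ∎)))
          where
          open ≡-Reasoning
          lem : ∀ z → z - - 1ℤ ≡ 1ℤ + z
          lem = solve-∀

    ⟦_⟧ : Fin p → ℤ
    ⟦ i ⟧ = + toℕ i

    abstract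
      residue : ℤ → Fin p
      residue z = fromℕ< (n%ℕd<d z p)

      residue-≈ : ∀ z → ⟦ residue z ⟧ ≈ z
      residue-≈ z = mod (divides (- (z /ℕ p)) (begin
        ⟦ residue z ⟧ - z                                        ≡⟨ cong (λ r → + r - z) (toℕ-fromℕ< (n%ℕd<d z p)) ⟩
        + (z %ℕ p) - z                                           ≡⟨ cong (λ y → + (z %ℕ p) - y) (a≡a%ℕn+[a/ℕn]*n z p) ⟩
        + (z %ℕ p) - (+ (z %ℕ p) + (z /ℕ p) * + p)               ≡⟨ lem (+ (z %ℕ p)) (z /ℕ p) (+ p) ⟩
        - (z /ℕ p) * + p                                         ∎))
        where
        open ≡-Reasoning
        lem : ∀ r q p → r - (r + q * p) ≡ - q * p
        lem = solve-∀

      ⟦⟧-injective : ∀ {i j} → ⟦ i ⟧ ≈ ⟦ j ⟧ → i ≡ j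
      ⟦⟧-injective {i} {j} (mod d) = toℕ-injective (+-injective (i-j≡0⇒i≡j ⟦ i ⟧ ⟦ j ⟧ (∣i∣≡0⇒i≡0 small)))
        where
        bound : ∣ ⟦ i ⟧ - ⟦ j ⟧ ∣ ℕ.< p
        bound = ℕ.≤-<-trans (ℕ.≤-trans (ℕ.≤-reflexive (cong ∣_∣ (m-n≡m⊖n (toℕ i) (toℕ j)))) (∣m⊝n∣≤m⊔n (toℕ i) (toℕ j)))
                  (ℕ.⊔-lub (toℕ<n i) (toℕ<n j))
        small : ∣ ⟦ i ⟧ - ⟦ j ⟧ ∣ ≡ 0
        small with ∣ ⟦ i ⟧ - ⟦ j ⟧ ∣ | bound | ∣⇒∣ᵤ d
        ... | zero  | _ | _ = refl
        ... | suc k | b | e = contradiction (ℕ.∣⇒≤ e) (ℕ.<⇒≱ b)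

      residue-cong : ∀ {x y} → x ≈ y → residue x ≡ residue y
      residue-cong {x} {y} h = ⟦⟧-injective (≈-trans (residue-≈ x) (≈-trans h (≈-sym (residue-≈ y))))

      residue-≡ : ∀ {x y} → residue x ≡ residue y → x ≈ y
      residue-≡ {x} {y} h = ≈-trans (≈-sym (residue-≈ x)) (≈-trans (≈-reflexive (cong ⟦_⟧ h)) (residue-≈ y))

    -- Polynomials and their roots.

    eval : ∀ {k} → Vec ℤ k → ℤ → ℤ
    eval []       x = 0ℤ
    eval (c ∷ cs) x = c + x * eval cs x

    -- Synthetic division by X - r, with coefficients listed from the constant term upwards: the
    -- quotient's coefficients are the Horner values at r of the successive tails.
    quotient : ∀ {k} → Vec ℤ (suc k) → ℤ → Vec ℤ k
    quotient (c ∷ [])         r = []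
    quotient (c ∷ cs@(_ ∷ _)) r = eval cs r ∷ quotient cs r

    quotient-correct : ∀ {k} (f : Vec ℤ (suc k)) r x → eval f x - eval f r ≡ (x - r) * eval (quotient f r) x
    quotient-correct (c ∷ [])         r x = lem c r x
      where
      lem : ∀ c r x → c + x * 0ℤ - (c + r * 0ℤ) ≡ (x - r) * 0ℤ
      lem = solve-∀
    quotient-correct (c ∷ cs@(_ ∷ _)) r x = begin
      c + x * g x - (c + r * g r)                      ≡⟨ lem₁ c x r (g x) (g r) ⟩
      x * (g x - g r) + (x - r) * g r                  ≡⟨ cong (λ z → x * z + (x - r) * g r) (quotient-correct cs r x) ⟩
      x * ((x - r) * h) + (x - r) * g r                ≡⟨ lem₂ x (x - r) h (g r) ⟩
      (x - r) * (g r + x * h)                          ∎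
      where
      open ≡-Reasoning
      g : ℤ → ℤ
      g = eval cs
      h : ℤ
      h = eval (quotient cs r) x
      lem₁ : ∀ c x r gx gr → c + x * gx - (c + r * gr) ≡ x * (gx - gr) + (x - r) * gr
      lem₁ = solve-∀
      lem₂ : ∀ x d h gr → x * (d * h) + d * gr ≡ d * (gr + x * h)
      lem₂ = solve-∀

    eval-zero : ∀ {k} {f : Vec ℤ k} → All (_≈ 0ℤ) f → ∀ x → eval f x ≈ 0ℤ
    eval-zero []       x = ≈-refl
    eval-zero (c ∷ cs) x = ≈-trans (+-cong c (*-congr (≈-refl {x}) (eval-zero cs x))) (≈-reflexive (lem x))
      where
      lem : ∀ x → 0ℤ + x * 0ℤ ≡ 0ℤ
      lem = solve-∀

    constant-zero : ∀ {k} c {cs : Vec ℤ k} r → eval (c ∷ cs) r ≈ 0ℤ → eval cs r ≈ 0ℤ → c ≈ 0ℤ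
    constant-zero c {cs} r = ≈-by₂ 1ℤ (- r) (lem c r (eval cs r))
      where
      lem : ∀ c r e → c - 0ℤ ≡ 1ℤ * (c + r * e - 0ℤ) + - r * (e - 0ℤ)
      lem = solve-∀

    quotient-zero : ∀ {k} (f : Vec ℤ (suc k)) r → eval f r ≈ 0ℤ → All (_≈ 0ℤ) (quotient f r) → All (_≈ 0ℤ) f
    quotient-zero (c ∷ [])         r fr _        = constant-zero c {[]} r fr ≈-refl ∷ []
    quotient-zero (c ∷ cs@(_ ∷ _)) r fr (g ∷ qs) = constant-zero c {cs} r fr g ∷ quotient-zero cs r g qs

    quotient-root : ∀ {k} (f : Vec ℤ (suc k)) {r x} → x ≉ r → eval f r ≈ 0ℤ → eval f x ≈ 0ℤ →
                    eval (quotient f r) x ≈ 0ℤ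
    quotient-root f {r} {x} x≉r fr fx =
      [ (λ x≈r → contradiction (difference≈0⁻ x≈r) x≉r) , (λ qx → qx) ]′
        (*-zero {x - r} {eval (quotient f r) x}
          (≈-trans (≈-reflexive (sym (quotient-correct f r x))) (difference≈0 (≈-trans fx (≈-sym fr)))))

    -- A vector of length k is a polynomial of degree below k. Divide by X minus the first root; the
    -- others remain roots of the quotient because there are no zero divisors modulo p.
    roots⇒zero : ∀ {k} (f : Vec ℤ k) (r : Fin k → ℤ) → (∀ {i j} → r i ≈ r j → i ≡ j) →
                 (∀ i → eval f (r i) ≈ 0ℤ) → All (_≈ 0ℤ) f
    roots⇒zero {zero}  []  r inj root = []
    roots⇒zero {suc k} f r inj root = quotient-zero f (r zero) (root zero)
      (roots⇒zero (quotient f (r zero)) (r ∘ suc) (λ {i} {j} h → Fin.suc-injective (inj {suc i} {suc j} h))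
        λ i → quotient-root f {r zero} {r (suc i)} (λ h → contradiction (inj {suc i} {zero} h) λ ())
                (root zero) (root (suc i)))

  -- Two quadratic extensions: from 𝔽_p to 𝔽_{p²} to 𝔽_{p⁴}.

  module Forms (p : ℕ) (pp : Prime p) where

    open Congruence p pp

    -- With i² = - a and β = b₁ + b₂ i, these are the real and imaginary parts of
    -- z² - β w² for z = x₀ + x₁ i and w = x₂ + x₃ i.
    form₁ form₂ : (a b₁ b₂ x₀ x₁ x₂ x₃ : ℤ) → ℤ
    form₁ a b₁ b₂ x₀ x₁ x₂ x₃ =
      (x₀ * x₀ - a * (x₁ * x₁)) - (b₁ * (x₂ * x₂ - a * (x₃ * x₃)) - a * (b₂ * (x₂ * x₃ + x₂ * x₃)))
    form₂ a b₁ b₂ x₀ x₁ x₂ x₃ =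
      (x₀ * x₁ + x₀ * x₁) - (b₁ * (x₂ * x₃ + x₂ * x₃) + b₂ * (x₂ * x₂ - a * (x₃ * x₃)))

    -- Equivalently -a is a nonsquare modulo p, so that 𝔽_p[i] with i² = -a is a field; the form is
    -- its norm.
    Anisotropic : ℤ → Set
    Anisotropic a = ∀ u v → u * u + a * (v * v) ≈ 0ℤ → u ≈ 0ℤ × v ≈ 0ℤ

    module Odd (2≉0 : + 2 ≉ 0ℤ) where

      1≉-1 : residue 1ℤ ≢ residue (- 1ℤ)
      1≉-1 eq = 2≉0 (≈-by 1ℤ refl (residue-≡ eq))

      residue-square : ∀ z → ⟦ residue z ⟧ * ⟦ residue z ⟧ ≈ z * z
      residue-square z = *-congr (residue-≈ z) (residue-≈ z)

      -- Squaring on 𝔽_p identifies the distinct elements 1 and -1, so it misses some c; take a =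
      -- -c. A zero of u² - c v² with v invertible would make c the square of u / v.
      ∃anisotropic : ∃ Anisotropic
      ∃anisotropic = - ⟦ c ⟧ , anisotropic
        where
        f : Fin p → Fin p
        f x = residue (⟦ x ⟧ * ⟦ x ⟧)
        nonsquare : ∃ λ c → ∀ x → f x ≢ c
        nonsquare = collision⇒not-surjective f 1≉-1
          (residue-cong (≈-trans (residue-square 1ℤ) (≈-sym (residue-square (- 1ℤ)))))
        c = proj₁ nonsquare
        v≈0 : ∀ u v → u * u + - ⟦ c ⟧ * (v * v) ≈ 0ℤ → v ≈ 0ℤ
        v≈0 u v h with v ≈? 0ℤ
        ... | yes v≈0 = v≈0
        ... | no  v≉0 with *-inverse v≉0
        ...   | m , vm≈1 = contradiction (⟦⟧-injective (≈-trans (residue-≈ _)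
                  (≈-trans (residue-square (u * m)) (≈-by₂ (m * m) (⟦ c ⟧ * (v * m + 1ℤ)) (lem u v m ⟦ c ⟧) h vm≈1))))
                  (proj₂ nonsquare (residue (u * m)))
          where
          lem : ∀ u v m c → u * m * (u * m) - c ≡
                m * m * (u * u + - c * (v * v) - 0ℤ) + c * (v * m + 1ℤ) * (v * m - 1ℤ)
          lem = solve-∀
        anisotropic : Anisotropic (- ⟦ c ⟧)
        anisotropic u v h = square-zero (≈-by₂ 1ℤ (⟦ c ⟧ * v) (lem u v ⟦ c ⟧) h (v≈0 u v h)) , v≈0 u v h
          where
          lem : ∀ u v c → u * u - 0ℤ ≡ 1ℤ * (u * u + - c * (v * v) - 0ℤ) + c * v * (v - 0ℤ)
          lem = solve-∀

      -- The same argument in 𝔽_{p²}, coded as `Fin (p * p)`: squaring misses some β = b₁ + b₂ i. If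
      -- both forms vanish then z² = β w², where w ≠ 0 would make β a square, and w = 0 leaves z² =
      -- 0.
      ∃β : ∀ {a} → Anisotropic a → ∃₂ λ b₁ b₂ → ∀ x₀ x₁ x₂ x₃ →
           form₁ a b₁ b₂ x₀ x₁ x₂ x₃ ≈ 0ℤ → form₂ a b₁ b₂ x₀ x₁ x₂ x₃ ≈ 0ℤ →
           (x₀ ≈ 0ℤ × x₁ ≈ 0ℤ) × (x₂ ≈ 0ℤ × x₃ ≈ 0ℤ)
      ∃β {a} aniso = b₁ , b₂ , trivial
        where
        re im : ℤ → ℤ → ℤ
        re u v = u * u - a * (v * v)
        im u v = u * v + u * v
        pair : ℤ → ℤ → Fin (p ℕ.* p)
        pair u v = combine (residue u) (residue v)
        pair-cong : ∀ {u u′ v v′} → u ≈ u′ → v ≈ v′ → pair u v ≡ pair u′ v′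
        pair-cong e f = cong₂ combine (residue-cong e) (residue-cong f)
        square : Fin p × Fin p → Fin (p ℕ.* p)
        square (u , v) = pair (re ⟦ u ⟧ ⟦ v ⟧) (im ⟦ u ⟧ ⟦ v ⟧)
        f : Fin (p ℕ.* p) → Fin (p ℕ.* p)
        f = square ∘ remQuot {p} p
        f-pair : ∀ u v → f (pair u v) ≡ pair (re u v) (im u v)
        f-pair u v = trans (cong square (Fin.remQuot-combine (residue u) (residue v)))
          (pair-cong (-‿cong (*-congr u′ u′) (*-congr (≈-refl {a}) (*-congr v′ v′))) (+-cong (*-congr u′ v′) (*-congr u′ v′)))
          where
          u′ = residue-≈ u
          v′ = residue-≈ v
        nonsquare : ∃ λ c → ∀ x → f x ≢ c
        nonsquare = collision⇒not-surjective f {pair 1ℤ 0ℤ} {pair (- 1ℤ) 0ℤ}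
          (1≉-1 ∘ Fin.combine-injectiveˡ (residue 1ℤ) (residue 0ℤ) (residue (- 1ℤ)) (residue 0ℤ))
          (trans (f-pair 1ℤ 0ℤ) (trans (pair-cong (≈-reflexive refl) ≈-refl) (sym (f-pair (- 1ℤ) 0ℤ))))
        b₁ = ⟦ proj₁ (remQuot {p} p (proj₁ nonsquare)) ⟧
        b₂ = ⟦ proj₂ (remQuot {p} p (proj₁ nonsquare)) ⟧
        pair-b : pair b₁ b₂ ≡ proj₁ nonsquare
        pair-b = trans (cong₂ combine (⟦⟧-injective (residue-≈ _)) (⟦⟧-injective (residue-≈ _)))
                   (Fin.combine-remQuot {p} p (proj₁ nonsquare))

        -- If w is invertible with inverse m · conj w, then z² = β w² exhibits β as a square.
        norm≈0 : ∀ x₀ x₁ x₂ x₃ → form₁ a b₁ b₂ x₀ x₁ x₂ x₃ ≈ 0ℤ → form₂ a b₁ b₂ x₀ x₁ x₂ x₃ ≈ 0ℤ →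
                 x₂ * x₂ + a * (x₃ * x₃) ≈ 0ℤ
        norm≈0 x₀ x₁ x₂ x₃ h₁ h₂ with (x₂ * x₂ + a * (x₃ * x₃)) ≈? 0ℤ
        ... | yes M≈0 = M≈0
        ... | no  M≉0 with *-inverse M≉0
        ...   | m , Mm≈1 = contradiction
                  (trans (f-pair y₁ y₂) (trans (pair-cong
                    (combine₃ (m * m * (x₂ * x₂ - a * (x₃ * x₃))) (m * m * a * (x₂ * x₃ + x₂ * x₃)) (b₁ * (M * m + 1ℤ))
                      (lem₁ a b₁ b₂ m x₀ x₁ x₂ x₃))
                    (combine₃ (- (m * m * (x₂ * x₃ + x₂ * x₃))) (m * m * (x₂ * x₂ - a * (x₃ * x₃))) (b₂ * (M * m + 1ℤ))
                      (lem₂ a b₁ b₂ m x₀ x₁ x₂ x₃))) pair-b))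
                  (proj₂ nonsquare (pair y₁ y₂))
          where
          M = x₂ * x₂ + a * (x₃ * x₃)
          -- y₁ + y₂ i is z · conj w · m, that is z / w.
          y₁ = (x₀ * x₂ + a * (x₁ * x₃)) * m
          y₂ = (x₁ * x₂ - x₀ * x₃) * m
          combine₃ : ∀ {y b} k l q → y - b ≡
            k * form₁ a b₁ b₂ x₀ x₁ x₂ x₃ + l * form₂ a b₁ b₂ x₀ x₁ x₂ x₃ + q * (M * m - 1ℤ) → y ≈ b
          combine₃ k l q eq = difference≈0⁻ (≈-trans (≈-reflexive eq)
            (≈-trans (+-cong (+-cong (*-congr (≈-refl {k}) h₁) (*-congr (≈-refl {l}) h₂))
                       (*-congr (≈-refl {q}) (difference≈0 Mm≈1)))
              (≈-reflexive (zeros k l q))))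
            where
            zeros : ∀ k l q → k * 0ℤ + l * 0ℤ + q * 0ℤ ≡ 0ℤ
            zeros = solve-∀
          lem₁ : ∀ a b₁ b₂ m x₀ x₁ x₂ x₃ →
            (x₀ * x₂ + a * (x₁ * x₃)) * m * ((x₀ * x₂ + a * (x₁ * x₃)) * m) - a * ((x₁ * x₂ - x₀ * x₃) * m * ((x₁ * x₂ - x₀ * x₃) * m)) - b₁ ≡
            m * m * (x₂ * x₂ - a * (x₃ * x₃)) * ((x₀ * x₀ - a * (x₁ * x₁)) - (b₁ * (x₂ * x₂ - a * (x₃ * x₃)) - a * (b₂ * (x₂ * x₃ + x₂ * x₃))))
            + m * m * a * (x₂ * x₃ + x₂ * x₃) * ((x₀ * x₁ + x₀ * x₁) - (b₁ * (x₂ * x₃ + x₂ * x₃) + b₂ * (x₂ * x₂ - a * (x₃ * x₃))))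
            + b₁ * ((x₂ * x₂ + a * (x₃ * x₃)) * m + 1ℤ) * ((x₂ * x₂ + a * (x₃ * x₃)) * m - 1ℤ)
          lem₁ = solve-∀
          lem₂ : ∀ a b₁ b₂ m x₀ x₁ x₂ x₃ →
            (x₀ * x₂ + a * (x₁ * x₃)) * m * ((x₁ * x₂ - x₀ * x₃) * m) + (x₀ * x₂ + a * (x₁ * x₃)) * m * ((x₁ * x₂ - x₀ * x₃) * m) - b₂ ≡
            - (m * m * (x₂ * x₃ + x₂ * x₃)) * ((x₀ * x₀ - a * (x₁ * x₁)) - (b₁ * (x₂ * x₂ - a * (x₃ * x₃)) - a * (b₂ * (x₂ * x₃ + x₂ * x₃))))
            + m * m * (x₂ * x₂ - a * (x₃ * x₃)) * ((x₀ * x₁ + x₀ * x₁) - (b₁ * (x₂ * x₃ + x₂ * x₃) + b₂ * (x₂ * x₂ - a * (x₃ * x₃))))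
            + b₂ * ((x₂ * x₂ + a * (x₃ * x₃)) * m + 1ℤ) * ((x₂ * x₂ + a * (x₃ * x₃)) * m - 1ℤ)
          lem₂ = solve-∀

        -- The norm is multiplicative: (u² + a v²)² = re² + a im².
        square≈0 : ∀ u v → re u v ≈ 0ℤ → im u v ≈ 0ℤ → u ≈ 0ℤ × v ≈ 0ℤ
        square≈0 u v h₁ h₂ = aniso u v (square-zero (≈-by₂ (u * u - a * (v * v)) (a * (u * v + u * v)) (lem a u v) h₁ h₂))
          where
          lem : ∀ a u v → (u * u + a * (v * v)) * (u * u + a * (v * v)) - 0ℤ ≡
                (u * u - a * (v * v)) * (u * u - a * (v * v) - 0ℤ) + a * (u * v + u * v) * (u * v + u * v - 0ℤ)
          lem = solve-∀

        trivial : ∀ x₀ x₁ x₂ x₃ → form₁ a b₁ b₂ x₀ x₁ x₂ x₃ ≈ 0ℤ → form₂ a b₁ b₂ x₀ x₁ x₂ x₃ ≈ 0ℤ →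
                  (x₀ ≈ 0ℤ × x₁ ≈ 0ℤ) × (x₂ ≈ 0ℤ × x₃ ≈ 0ℤ)
        trivial x₀ x₁ x₂ x₃ h₁ h₂ with aniso x₂ x₃ (norm≈0 x₀ x₁ x₂ x₃ h₁ h₂)
        ... | z₂ , z₃ = square≈0 x₀ x₁
                (≈-trans (≈-sym (≈-trans (-‿cong (≈-refl {re x₀ x₁}) w₁) (≈-reflexive (lem (re x₀ x₁))))) h₁)
                (≈-trans (≈-sym (≈-trans (-‿cong (≈-refl {im x₀ x₁}) w₂) (≈-reflexive (lem (im x₀ x₁))))) h₂) , z₂ , z₃
          where
          lem : ∀ x → x - 0ℤ ≡ x
          lem = solve-∀
          w₁ : b₁ * re x₂ x₃ - a * (b₂ * im x₂ x₃) ≈ 0ℤ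
          w₁ = ≈-by₂ (b₁ * x₂) (- (b₁ * a * x₃) - a * b₂ * (x₂ + x₂)) (lem₁ a b₁ b₂ x₂ x₃) z₂ z₃
            where
            lem₁ : ∀ a b₁ b₂ x₂ x₃ → b₁ * (x₂ * x₂ - a * (x₃ * x₃)) - a * (b₂ * (x₂ * x₃ + x₂ * x₃)) - 0ℤ ≡
                   b₁ * x₂ * (x₂ - 0ℤ) + (- (b₁ * a * x₃) - a * b₂ * (x₂ + x₂)) * (x₃ - 0ℤ)
            lem₁ = solve-∀
          w₂ : b₁ * im x₂ x₃ + b₂ * re x₂ x₃ ≈ 0ℤ
          w₂ = ≈-by₂ (b₂ * x₂) (b₁ * (x₂ + x₂) - b₂ * a * x₃) (lem₂ a b₁ b₂ x₂ x₃) z₂ z₃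
            where
            lem₂ : ∀ a b₁ b₂ x₂ x₃ → b₁ * (x₂ * x₃ + x₂ * x₃) + b₂ * (x₂ * x₂ - a * (x₃ * x₃)) - 0ℤ ≡
                   b₂ * x₂ * (x₂ - 0ℤ) + (b₁ * (x₂ + x₂) - b₂ * a * x₃) * (x₃ - 0ℤ)
            lem₂ = solve-∀

  -- Lines and points in 𝔽_p⁶.

  module Geometry (p : ℕ) (pp : Prime p) where

    open Congruence p pp
    open Forms p pp

    -- The properties of the norm form through which the incidence argument sees it. `N-shift`
    -- records that on the line through d in direction x it is a quartic polynomial with constant
    -- term N d and leading coefficient N x.
    record AnisotropicQuartic : Set where
      field
        N             : (Fin 4 → ℤ) → ℤ
        N-cong        : ∀ {x y} → (∀ k → x k ≈ y k) → N x ≈ N y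
        N-anisotropic : ∀ x → N x ≈ 0ℤ → ∀ k → x k ≈ 0ℤ
        N-scale       : ∀ s x → N (λ k → s * x k) ≡ s * (s * (s * (s * N x)))
        N-shift       : ∀ x d → Σ (ℤ × ℤ × ℤ) λ (c₁ , c₂ , c₃) → ∀ s →
                        N (λ k → s * x k + d k) ≡ eval (N d ∷ c₁ ∷ c₂ ∷ c₃ ∷ N x ∷ []) s

    -- The witness m is the polar form q(x + y) - q(x) - q(y) of the quadratic form q = `form₁`.
    polar₁ : ∀ a b₁ b₂ x₀ x₁ x₂ x₃ y₀ y₁ y₂ y₃ → ∃ λ m → ∀ s →
      form₁ a b₁ b₂ (s * x₀ + y₀) (s * x₁ + y₁) (s * x₂ + y₂) (s * x₃ + y₃) ≡
      s * s * form₁ a b₁ b₂ x₀ x₁ x₂ x₃ + s * m + form₁ a b₁ b₂ y₀ y₁ y₂ y₃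
    polar₁ a b₁ b₂ x₀ x₁ x₂ x₃ y₀ y₁ y₂ y₃ = m , λ s → lem a b₁ b₂ x₀ x₁ x₂ x₃ y₀ y₁ y₂ y₃ s
      where
      m = + 2 * ((x₀ * y₀ - a * (x₁ * y₁)) - (b₁ * (x₂ * y₂ - a * (x₃ * y₃)) - a * (b₂ * (x₂ * y₃ + x₃ * y₂))))
      lem : ∀ a b₁ b₂ x₀ x₁ x₂ x₃ y₀ y₁ y₂ y₃ s →
        ((s * x₀ + y₀) * (s * x₀ + y₀) - a * ((s * x₁ + y₁) * (s * x₁ + y₁))) - (b₁ * ((s * x₂ + y₂) * (s * x₂ + y₂) - a * ((s * x₃ + y₃) * (s * x₃ + y₃))) - a * (b₂ * ((s * x₂ + y₂) * (s * x₃ + y₃) + (s * x₂ + y₂) * (s * x₃ + y₃)))) ≡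
        s * s * ((x₀ * x₀ - a * (x₁ * x₁)) - (b₁ * (x₂ * x₂ - a * (x₃ * x₃)) - a * (b₂ * (x₂ * x₃ + x₂ * x₃))))
        + s * (+ 2 * ((x₀ * y₀ - a * (x₁ * y₁)) - (b₁ * (x₂ * y₂ - a * (x₃ * y₃)) - a * (b₂ * (x₂ * y₃ + x₃ * y₂)))))
        + ((y₀ * y₀ - a * (y₁ * y₁)) - (b₁ * (y₂ * y₂ - a * (y₃ * y₃)) - a * (b₂ * (y₂ * y₃ + y₂ * y₃))))
      lem = solve-∀

    polar₂ : ∀ a b₁ b₂ x₀ x₁ x₂ x₃ y₀ y₁ y₂ y₃ → ∃ λ m → ∀ s →
      form₂ a b₁ b₂ (s * x₀ + y₀) (s * x₁ + y₁) (s * x₂ + y₂) (s * x₃ + y₃) ≡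
      s * s * form₂ a b₁ b₂ x₀ x₁ x₂ x₃ + s * m + form₂ a b₁ b₂ y₀ y₁ y₂ y₃
    polar₂ a b₁ b₂ x₀ x₁ x₂ x₃ y₀ y₁ y₂ y₃ = m , λ s → lem a b₁ b₂ x₀ x₁ x₂ x₃ y₀ y₁ y₂ y₃ s
      where
      m = + 2 * ((x₀ * y₁ + x₁ * y₀) - (b₁ * (x₂ * y₃ + x₃ * y₂) + b₂ * (x₂ * y₂ - a * (x₃ * y₃))))
      lem : ∀ a b₁ b₂ x₀ x₁ x₂ x₃ y₀ y₁ y₂ y₃ s →
        ((s * x₀ + y₀) * (s * x₁ + y₁) + (s * x₀ + y₀) * (s * x₁ + y₁)) - (b₁ * ((s * x₂ + y₂) * (s * x₃ + y₃) + (s * x₂ + y₂) * (s * x₃ + y₃)) + b₂ * ((s * x₂ + y₂) * (s * x₂ + y₂) - a * ((s * x₃ + y₃) * (s * x₃ + y₃)))) ≡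
        s * s * ((x₀ * x₁ + x₀ * x₁) - (b₁ * (x₂ * x₃ + x₂ * x₃) + b₂ * (x₂ * x₂ - a * (x₃ * x₃))))
        + s * (+ 2 * ((x₀ * y₁ + x₁ * y₀) - (b₁ * (x₂ * y₃ + x₃ * y₂) + b₂ * (x₂ * y₂ - a * (x₃ * y₃)))))
        + ((y₀ * y₁ + y₀ * y₁) - (b₁ * (y₂ * y₃ + y₂ * y₃) + b₂ * (y₂ * y₂ - a * (y₃ * y₃))))
      lem = solve-∀

    -- A composition of two norms: z² - β w² goes from 𝔽_{p⁴} to 𝔽_{p²}, with components P₁ and P₂,
    -- and P₁² + a P₂² goes on to 𝔽_p. Each stage vanishes only at zero.
    anisotropicQuartic : + 2 ≉ 0ℤ → AnisotropicQuartic
    anisotropicQuartic 2≉0 = quartic (Odd.∃anisotropic 2≉0)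
      where
      quartic : ∃ Anisotropic → AnisotropicQuartic
      quartic (a , aniso) = record
        { N = N ; N-cong = N-cong ; N-anisotropic = N-anisotropic ; N-scale = N-scale ; N-shift = N-shift }
        where
        ∃β = Odd.∃β 2≉0 {a} aniso
        b₁ = proj₁ ∃β
        b₂ = proj₁ (proj₂ ∃β)
        P₁ P₂ N : (Fin 4 → ℤ) → ℤ
        P₁ x = form₁ a b₁ b₂ (x 0F) (x 1F) (x 2F) (x 3F)
        P₂ x = form₂ a b₁ b₂ (x 0F) (x 1F) (x 2F) (x 3F)
        N x = P₁ x * P₁ x + a * (P₂ x * P₂ x)
        module _ {x y : Fin 4 → ℤ} (h : ∀ k → x k ≈ y k) where
          P₁-cong : P₁ x ≈ P₁ y
          P₁-cong = -‿cong (-‿cong (*-congr (h 0F) (h 0F)) (*-congr (≈-refl {a}) (*-congr (h 1F) (h 1F))))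
            (-‿cong (*-congr (≈-refl {b₁}) (-‿cong (*-congr (h 2F) (h 2F)) (*-congr (≈-refl {a}) (*-congr (h 3F) (h 3F)))))
              (*-congr (≈-refl {a}) (*-congr (≈-refl {b₂}) (+-cong (*-congr (h 2F) (h 3F)) (*-congr (h 2F) (h 3F))))))
          P₂-cong : P₂ x ≈ P₂ y
          P₂-cong = -‿cong (+-cong (*-congr (h 0F) (h 1F)) (*-congr (h 0F) (h 1F)))
            (+-cong (*-congr (≈-refl {b₁}) (+-cong (*-congr (h 2F) (h 3F)) (*-congr (h 2F) (h 3F))))
              (*-congr (≈-refl {b₂}) (-‿cong (*-congr (h 2F) (h 2F)) (*-congr (≈-refl {a}) (*-congr (h 3F) (h 3F))))))
          N-cong : N x ≈ N y
          N-cong = +-cong (*-congr P₁-cong P₁-cong) (*-congr (≈-refl {a}) (*-congr P₂-cong P₂-cong))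
        N-anisotropic : ∀ x → N x ≈ 0ℤ → ∀ k → x k ≈ 0ℤ
        N-anisotropic x h = pick (proj₂ (proj₂ ∃β) (x 0F) (x 1F) (x 2F) (x 3F) (proj₁ P≈0) (proj₂ P≈0))
          where
          P≈0 = aniso (P₁ x) (P₂ x) h
          pick : (x 0F ≈ 0ℤ × x 1F ≈ 0ℤ) × (x 2F ≈ 0ℤ × x 3F ≈ 0ℤ) → ∀ k → x k ≈ 0ℤ
          pick ((z , _) , _) 0F = z
          pick ((_ , z) , _) 1F = z
          pick (_ , (z , _)) 2F = z
          pick (_ , (_ , z)) 3F = z
        scale₁ : ∀ a b₁ b₂ x₀ x₁ x₂ x₃ s →
          ((s * x₀) * (s * x₀) - a * ((s * x₁) * (s * x₁))) - (b₁ * ((s * x₂) * (s * x₂) - a * ((s * x₃) * (s * x₃))) - a * (b₂ * ((s * x₂) * (s * x₃) + (s * x₂) * (s * x₃)))) ≡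
          s * s * ((x₀ * x₀ - a * (x₁ * x₁)) - (b₁ * (x₂ * x₂ - a * (x₃ * x₃)) - a * (b₂ * (x₂ * x₃ + x₂ * x₃))))
        scale₁ = solve-∀
        scale₂ : ∀ a b₁ b₂ x₀ x₁ x₂ x₃ s →
          ((s * x₀) * (s * x₁) + (s * x₀) * (s * x₁)) - (b₁ * ((s * x₂) * (s * x₃) + (s * x₂) * (s * x₃)) + b₂ * ((s * x₂) * (s * x₂) - a * ((s * x₃) * (s * x₃)))) ≡
          s * s * ((x₀ * x₁ + x₀ * x₁) - (b₁ * (x₂ * x₃ + x₂ * x₃) + b₂ * (x₂ * x₂ - a * (x₃ * x₃))))
        scale₂ = solve-∀
        N-scale : ∀ s x → N (λ k → s * x k) ≡ s * (s * (s * (s * N x)))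
        N-scale s x = trans
          (cong₂ (λ u v → u * u + a * (v * v)) (scale₁ a b₁ b₂ (x 0F) (x 1F) (x 2F) (x 3F) s) (scale₂ a b₁ b₂ (x 0F) (x 1F) (x 2F) (x 3F) s))
          (lem a s (P₁ x) (P₂ x))
          where
          lem : ∀ a s u v → s * s * u * (s * s * u) + a * (s * s * v * (s * s * v)) ≡ s * (s * (s * (s * (u * u + a * (v * v)))))
          lem = solve-∀
        N-shift : ∀ x d → Σ (ℤ × ℤ × ℤ) λ (c₁ , c₂ , c₃) → ∀ s →
                  N (λ k → s * x k + d k) ≡ eval (N d ∷ c₁ ∷ c₂ ∷ c₃ ∷ N x ∷ []) s
        -- The coefficients of s, s² and s³ in (u s² + m s + k)² + a (v s² + n s + l)².
        N-shift x d = (+ 2 * (m * k + a * (n * l)) , m * m + + 2 * (u * k) + a * (n * n + + 2 * (v * l)) , + 2 * (u * m + a * (v * n))) , λ s → trans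
          (cong₂ (λ u v → u * u + a * (v * v)) (proj₂ m₁ s) (proj₂ m₂ s))
          (lem a s u v m n k l)
          where
          u = P₁ x
          v = P₂ x
          k = P₁ d
          l = P₂ d
          m₁ = polar₁ a b₁ b₂ (x 0F) (x 1F) (x 2F) (x 3F) (d 0F) (d 1F) (d 2F) (d 3F)
          m₂ = polar₂ a b₁ b₂ (x 0F) (x 1F) (x 2F) (x 3F) (d 0F) (d 1F) (d 2F) (d 3F)
          m = proj₁ m₁
          n = proj₁ m₂
          lem : ∀ a s u v m n k l →
            (s * s * u + s * m + k) * (s * s * u + s * m + k) + a * ((s * s * v + s * n + l) * (s * s * v + s * n + l)) ≡
            (k * k + a * (l * l)) + s * (+ 2 * (m * k + a * (n * l)) + s * ((m * m + + 2 * (u * k) + a * (n * n + + 2 * (v * l)))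
              + s * (+ 2 * (u * m + a * (v * n)) + s * ((u * u + a * (v * v)) + s * 0ℤ))))
          lem = solve-∀

    -- The line t ↦ (t , offset + t · slope , height + t · N(slope)) in 𝔽_p⁶. Its last direction
    -- coordinate is determined by the slope, so nine coordinates describe it.
    record Line : Set where
      constructor line
      field
        slope offset : Fin 4 → ℤ
        height       : ℤ

    record Point : Set where
      constructor point
      field
        time     : ℤ
        position : Fin 4 → ℤ
        height   : ℤ

    open Line using (slope; offset)
    open Point using (time; position)

    infix 4 _≈ˡ_ _≈ᵖ_
    _≈ˡ_ : Line → Line → Set
    L ≈ˡ L′ = (∀ k → slope L k ≈ slope L′ k) × (∀ k → offset L k ≈ offset L′ k) × Line.height L ≈ Line.height L′

    _≈ᵖ_ : Point → Point → Set
    P ≈ᵖ P′ = time P ≈ time P′ × (∀ k → position P k ≈ position P′ k) × Point.height P ≈ Point.height P′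

    module Incidence (Q : AnisotropicQuartic) where

      open AnisotropicQuartic Q

      record Incident (L : Line) (P : Point) : Set where
        constructor incident
        field
          on-position : ∀ k → position P k ≈ offset L k + time P * slope L k
          on-height   : Point.height P ≈ Line.height L + time P * N (slope L)
      open Incident

      same-time : ∀ {L P P′} → Incident L P → Incident L P′ → time P ≈ time P′ → P ≈ᵖ P′
      same-time {L} {P} {P′} P∈L P′∈L t = t
        , (λ k → same (offset L k) (slope L k) (on-position P∈L k) (on-position P′∈L k)) , same (Line.height L) (N (slope L)) (on-height P∈L) (on-height P′∈L)
        where
        same : ∀ {v v′} o x → v ≈ o + time P * x → v′ ≈ o + time P′ * x → v ≈ v′
        same o x e e′ = ≈-trans e (≈-trans (+-cong (≈-refl {o}) (*-congr t (≈-refl {x}))) (≈-sym e′))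

      parallel : ∀ {L L′ P} → Incident L P → Incident L′ P → (∀ k → slope L k ≈ slope L′ k) → L ≈ˡ L′
      parallel {L} {L′} {P} P∈L P∈L′ h = h
        , (λ k → cancel (offset L k) (offset L′ k) (on-position P∈L k) (on-position P∈L′ k) (h k))
        , cancel (Line.height L) (Line.height L′) (on-height P∈L) (on-height P∈L′) (N-cong h)
        where
        cancel : ∀ {v} o o′ {x x′} → v ≈ o + time P * x → v ≈ o′ + time P * x′ → x ≈ x′ → o ≈ o′
        cancel o o′ {x} {x′} e e′ f = ≈-trans (≈-trans (≈-reflexive (lem o (time P) x))
          (-‿cong (≈-trans (≈-sym e) e′) (*-congr (≈-refl {time P}) f))) (≈-reflexive (sym (lem o′ (time P) x′)))
          where
          lem : ∀ o t x → o ≡ o + t * x - t * x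
          lem = solve-∀

      -- Points of one line at equal times coincide. At different times, the displacement is (t -
      -- t′) times either slope; cancelling t - t′ makes the lines parallel, and they share a point.
      two-lines-two-points : ∀ {L L′ P P′} → Incident L P → Incident L′ P → Incident L P′ → Incident L′ P′ →
                             L ≈ˡ L′ ⊎ P ≈ᵖ P′
      two-lines-two-points {L} {L′} {P} {P′} i₁ i₂ i₃ i₄ with time P ≈? time P′
      ... | yes t = inj₂ (same-time i₁ i₃ t)
      ... | no ¬t = inj₁ (parallel i₁ i₂ λ k → *-cancel (¬t ∘ difference≈0⁻)
              (difference (offset L k) (offset L′ k) (on-position i₁ k) (on-position i₂ k) (on-position i₃ k) (on-position i₄ k)))
        where
        t  = time P
        t′ = time P′
        difference : ∀ {v v′} o o′ {x x′} → v ≈ o + t * x → v ≈ o′ + t * x′ → v′ ≈ o + t′ * x → v′ ≈ o′ + t′ * x′ →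
                     (t - t′) * x ≈ (t - t′) * x′
        difference o o′ {x} {x′} e₁ e₂ e₃ e₄ = ≈-trans (≈-reflexive (lem o t t′ x))
          (≈-trans (-‿cong (≈-trans (≈-sym e₁) e₂) (≈-trans (≈-sym e₃) e₄)) (≈-reflexive (sym (lem o′ t t′ x′))))
          where
          lem : ∀ o t t′ x → (t - t′) * x ≡ o + t * x - (o + t′ * x)
          lem = solve-∀

      -- In slope space the four paths force s N(ξᵢ) = s N(ξ) + e and s ξᵢ = s ξ + d for
      -- four values of s; the cubic in s that results has constant term N d.
      no-four-paths : ∀ {L R} (P : Fin 4 → Point) (M : Fin 4 → Line) →
        (∀ i → Incident L (P i)) → (∀ i → Incident (M i) (P i)) → (∀ i → Incident (M i) R) →
        (∀ {i j} → P i ≈ᵖ P j → i ≡ j) → (∀ i → ¬ P i ≈ᵖ R) → ¬ (∀ i → ¬ L ≈ˡ M i)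
      no-four-paths {L} {R} P M P∈L P∈M R∈M P-distinct P≉R L≉M =
        -- `N d ≈ 0` forces d to vanish, so `M 0F` has the slope of `L`; as both contain `P 0F`,
        -- they coincide.
        L≉M 0F (parallel (P∈L 0F) (P∈M 0F) λ k → ≈-sym (*-cancel (s≉0 0F) (≈-trans (slopes 0F k)
          (≈-trans (+-cong (≈-refl {s 0F * slope L k}) (N-anisotropic d (All.head Nd≈0) k)) (≈-reflexive (lem₀ (s 0F * slope L k)))))))
        where
        lem₀ : ∀ x → x + 0ℤ ≡ x
        lem₀ = solve-∀
        t₀ = time R
        s : Fin 4 → ℤ
        s i = time (P i) - t₀
        d : Fin 4 → ℤ
        -- `d` and `e` measure how far `R` is from the point of `L` at the same time `t₀`.
        d k = offset L k + t₀ * slope L k - position R k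
        e : ℤ
        e = Line.height L + t₀ * N (slope L) - Point.height R
        shift : ∀ {v r x x′} o o′ t → v ≈ o + t * x → v ≈ o′ + t * x′ → r ≈ o′ + t₀ * x′ →
                (t - t₀) * x′ ≈ (t - t₀) * x + (o + t₀ * x - r)
        shift {v} {r} {x} {x′} o o′ t e₁ e₂ e₃ = ≈-trans (≈-reflexive (lem₁ o′ t t₀ x′))
          (≈-trans (-‿cong (≈-trans (≈-sym e₂) e₁) (≈-sym e₃)) (≈-reflexive (lem₂ o t t₀ x r)))
          where
          lem₁ : ∀ o t t₀ x → (t - t₀) * x ≡ o + t * x - (o + t₀ * x)
          lem₁ = solve-∀
          lem₂ : ∀ o t t₀ x r → o + t * x - r ≡ (t - t₀) * x + (o + t₀ * x - r)
          lem₂ = solve-∀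
        slopes : ∀ i k → s i * slope (M i) k ≈ s i * slope L k + d k
        slopes i k = shift (offset L k) (offset (M i) k) (time (P i)) (on-position (P∈L i) k) (on-position (P∈M i) k) (on-position (R∈M i) k)
        heights : ∀ i → s i * N (slope (M i)) ≈ s i * N (slope L) + e
        heights i = shift (Line.height L) (Line.height (M i)) (time (P i)) (on-height (P∈L i)) (on-height (P∈M i)) (on-height (R∈M i))
        s≉0 : ∀ i → s i ≉ 0ℤ
        s≉0 i h = P≉R i (same-time (P∈M i) (R∈M i) (difference≈0⁻ h))
        s-injective : ∀ {i j} → s i ≈ s j → i ≡ j
        s-injective {i} {j} h = P-distinct (same-time (P∈L i) (P∈L j)
          (≈-by 1ℤ (lem (time (P i)) (time (P j)) t₀) h))
          where
          lem : ∀ x y t → x - y ≡ 1ℤ * (x - t - (y - t))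
          lem = solve-∀
        expansion = N-shift (slope L) d
        c₁ = proj₁ (proj₁ expansion)
        c₂ = proj₁ (proj₂ (proj₁ expansion))
        c₃ = proj₂ (proj₂ (proj₁ expansion))
        cubic : Vec ℤ 4
        -- Homogeneity and the height relation give N(s ξ + d) = s³ (s N(ξ) + e). Both sides have
        -- s⁴-coefficient N(ξ), so only a cubic remains, with s³-coefficient c₃ - e.
        cubic = N d ∷ c₁ ∷ c₂ ∷ (c₃ - e) ∷ []
        root : ∀ i → eval cubic (s i) ≈ 0ℤ
        root i = ≈-by 1ℤ (lem (N d) c₁ c₂ c₃ (N (slope L)) e (s i)) (≈-sym quartics)
          where
          quartics : s i * (s i * (s i * (s i * N (slope L) + e))) ≈ eval (N d ∷ c₁ ∷ c₂ ∷ c₃ ∷ N (slope L) ∷ []) (s i)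
          quartics = ≈-trans (*-congr (≈-refl {s i}) (*-congr (≈-refl {s i}) (*-congr (≈-refl {s i}) (≈-sym (heights i)))))
            (≈-trans (≈-reflexive (sym (N-scale (s i) (slope (M i)))))
              (≈-trans (N-cong (slopes i)) (≈-reflexive (proj₂ expansion (s i)))))
          lem : ∀ n c₁ c₂ c₃ m e s →
            n + s * (c₁ + s * (c₂ + s * ((c₃ - e) + s * 0ℤ))) - 0ℤ ≡
            1ℤ * (n + s * (c₁ + s * (c₂ + s * (c₃ + s * (m + s * 0ℤ)))) - s * (s * (s * (s * m + e))))
          lem = solve-∀
        Nd≈0 : All (_≈ 0ℤ) cubic
        Nd≈0 = roots⇒zero cubic s s-injective root

-- The incidence graph and its edge count.

module IncidenceGraph where

  open import Defs
  open import Data.Nat as ℕ using (ℕ; zero; suc; _≤_; _<_; _^_; _*_; z≤n; s≤s)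
  import Data.Nat.Properties as ℕ
  open import Data.Nat.DivMod using (_%_; m%n<n; m<n⇒m%n≡m)
  open import Data.Nat.Primality using (Prime; prime⇒nonZero)
  import Data.Integer as ℤ
  open import Data.Fin as Fin using (Fin; zero; suc; toℕ; fromℕ<; inject≤; combine; remQuot; finToFun; funToFin; _↑ˡ_; _↑ʳ_)
  open import Data.Fin.Patterns
  open import Data.Fin.Properties using (suc-injective; toℕ-injective; toℕ-fromℕ<; toℕ-inject≤; inject≤-injective; toℕ<n; combine-injective; combine-remQuot; finToFun-funToFin; funToFin-finToFin)
  open import Data.Fin.Subset using (Subset; ∣_∣; _∈_; _∪_; ⁅_⁆) renaming (⊥ to ∅)
  open import Data.Fin.Subset.Properties using (∉⊥; p⊆p∪q; q⊆p∪q; x∈p∪q⁻; x∈⁅x⁆; x∈⁅y⁆⇒x≡y; p⊂q⇒∣p∣<∣q∣)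
  open import Data.Product using (Σ; ∃; _×_; _,_; proj₁; proj₂; uncurry)
  open import Data.Sum using (inj₁; inj₂; [_,_]′)
  open import Data.Sum.Properties using (inj₁-injective; inj₂-injective)
  open import Data.Empty using (⊥)
  open import Data.List using ([]; _∷_)
  open import Data.List.Relation.Unary.All using ([]; _∷_)
  open import Function using (_∘_; Injective)
  open import Relation.Nullary using (¬_; no; contradiction)
  open import Relation.Binary.PropositionalEquality
  open AffineLines

  -- Singletons are adjoined one at a time; injectivity makes each value new, so the size grows at
  -- every step.
  image : ∀ {k N} (f : Fin k → Fin N) → Injective _≡_ _≡_ f →
          Σ (Subset N) λ E → (∀ {c} → c ∈ E → ∃ λ e → f e ≡ c) × k ≤ ∣ E ∣
  image {zero}  f inj = ∅ , (λ c∈ → contradiction c∈ ∉⊥) , z≤n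
  image {suc k} f inj with image (f ∘ suc) (suc-injective ∘ inj)
  ... | E , hit , k≤ = E ∪ ⁅ f zero ⁆ , hit′
      , ℕ.≤-trans (s≤s k≤) (p⊂q⇒∣p∣<∣q∣ (p⊆p∪q _ , f zero , q⊆p∪q E _ (x∈⁅x⁆ (f zero)) , fresh))
    where
    hit′ : ∀ {c} → c ∈ E ∪ ⁅ f zero ⁆ → ∃ λ e → f e ≡ c
    hit′ c∈ with x∈p∪q⁻ E ⁅ f zero ⁆ c∈
    ... | inj₁ c∈E = let e , eq = hit c∈E in suc e , eq
    ... | inj₂ c∈f = zero , sym (x∈⁅y⁆⇒x≡y (f zero) c∈f)
    fresh : ¬ f zero ∈ E
    fresh f∈E with hit f∈E
    ... | e , eq with inj eq
    ...   | ()

  funToFin-cong : ∀ {m n} {f g : Fin m → Fin n} → f ≗ g → funToFin f ≡ funToFin g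
  funToFin-cong {zero}  h = refl
  funToFin-cong {suc m} h = cong₂ combine (h zero) (funToFin-cong (h ∘ suc))

  finToFun-injective : ∀ {m n} {c d : Fin (n ^ m)} → finToFun {n} {m} c ≗ finToFun d → c ≡ d
  finToFun-injective {m} {n} {c} {d} h =
    trans (sym (funToFin-finToFin {m} {n} c)) (trans (funToFin-cong h) (funToFin-finToFin {m} {n} d))

  module _ {k n : ℕ} .{{_ : ℕ.NonZero k}} where

    -- A total left inverse of `inject≤`. The values at indices from k onwards are arbitrary: the
    -- corresponding vertices are isolated padding.
    wrap : Fin n → Fin k
    wrap i = fromℕ< (m%n<n (toℕ i) k)

    wrap-inject≤ : ∀ (h : k ≤ n) c → wrap (inject≤ c h) ≡ c
    wrap-inject≤ h c = toℕ-injective (trans (toℕ-fromℕ< _)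
      (trans (cong (_% k) (toℕ-inject≤ c h)) (m<n⇒m%n≡m (toℕ<n c))))

  module Construction {p : ℕ} (pp : Prime p) (2<p : 2 < p) {n m : ℕ} (p⁹≤n : p ^ 9 ≤ n) (p⁶≤m : p ^ 6 ≤ m) where

    open Congruence p pp
    open Geometry p pp

    private instance
      p≢0 : ℕ.NonZero p
      p≢0 = prime⇒nonZero pp
      p⁹≢0 : ℕ.NonZero (p ^ 9)
      p⁹≢0 = ℕ.m^n≢0 p 9
      p⁶≢0 : ℕ.NonZero (p ^ 6)
      p⁶≢0 = ℕ.m^n≢0 p 6

    2≉0 : ℤ.+ 2 ≉ ℤ.0ℤ
    2≉0 h = distinct (⟦⟧-injective (≈-trans (≈-reflexive (cong ℤ.+_ (toℕ-fromℕ< 2<p)))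
      (≈-trans h (≈-reflexive (cong ℤ.+_ (sym (toℕ-fromℕ< 0<p)))))))
      where
      0<p : 0 < p
      0<p = ℕ.<-trans (s≤s z≤n) 2<p
      distinct : fromℕ< 2<p ≢ fromℕ< 0<p
      distinct eq with trans (sym (toℕ-fromℕ< 2<p)) (trans (cong toℕ eq) (toℕ-fromℕ< 0<p))
      ... | ()

    abstract
      quartic : AnisotropicQuartic
      quartic = anisotropicQuartic 2≉0

    open Incidence quartic
    open AnisotropicQuartic quartic using (N)

    lineOf : Fin (p ^ 9) → Line
    lineOf c = line (λ k → ⟦ finToFun {p} {9} c (k ↑ˡ 5) ⟧) (λ k → ⟦ finToFun {p} {9} c (4 ↑ʳ (k ↑ˡ 1)) ⟧) ⟦ finToFun {p} {9} c 8F ⟧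

    pointOf : Fin (p ^ 6) → Point
    pointOf d = point ⟦ finToFun {p} {6} d 0F ⟧ (λ k → ⟦ finToFun {p} {6} d (suc (k ↑ˡ 1)) ⟧) ⟦ finToFun {p} {6} d 5F ⟧

    lineOf-injective : ∀ {c c′} → lineOf c ≈ˡ lineOf c′ → c ≡ c′
    lineOf-injective {c} {c′} (s , o , h) = finToFun-injective {9} {p} digits
      where
      digits : finToFun {p} {9} c ≗ finToFun c′
      digits 0F = ⟦⟧-injective (s 0F)
      digits 1F = ⟦⟧-injective (s 1F)
      digits 2F = ⟦⟧-injective (s 2F)
      digits 3F = ⟦⟧-injective (s 3F)
      digits 4F = ⟦⟧-injective (o 0F)
      digits 5F = ⟦⟧-injective (o 1F)
      digits 6F = ⟦⟧-injective (o 2F)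
      digits 7F = ⟦⟧-injective (o 3F)
      digits 8F = ⟦⟧-injective h

    pointOf-injective : ∀ {d d′} → pointOf d ≈ᵖ pointOf d′ → d ≡ d′
    pointOf-injective {d} {d′} (t , v , h) = finToFun-injective {6} {p} digits
      where
      digits : finToFun {p} {6} d ≗ finToFun d′
      digits 0F = ⟦⟧-injective t
      digits 1F = ⟦⟧-injective (v 0F)
      digits 2F = ⟦⟧-injective (v 1F)
      digits 3F = ⟦⟧-injective (v 2F)
      digits 4F = ⟦⟧-injective (v 3F)
      digits 5F = ⟦⟧-injective h

    digitsAt : Fin (p ^ 9) → Fin p → Fin 6 → Fin p
    digitsAt c t 0F = t
    digitsAt c t 1F = residue (Line.offset (lineOf c) 0F ℤ.+ ⟦ t ⟧ ℤ.* Line.slope (lineOf c) 0F)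
    digitsAt c t 2F = residue (Line.offset (lineOf c) 1F ℤ.+ ⟦ t ⟧ ℤ.* Line.slope (lineOf c) 1F)
    digitsAt c t 3F = residue (Line.offset (lineOf c) 2F ℤ.+ ⟦ t ⟧ ℤ.* Line.slope (lineOf c) 2F)
    digitsAt c t 4F = residue (Line.offset (lineOf c) 3F ℤ.+ ⟦ t ⟧ ℤ.* Line.slope (lineOf c) 3F)
    digitsAt c t 5F = residue (Line.height (lineOf c) ℤ.+ ⟦ t ⟧ ℤ.* N (Line.slope (lineOf c)))

    pointAt : Fin (p ^ 9) → Fin p → Fin (p ^ 6)
    pointAt c t = funToFin (digitsAt c t)

    pointAt-incident : ∀ c t → Incident (lineOf c) (pointOf (pointAt c t))
    pointAt-incident c t = incident positions (at 5F h (N x) (digit 5F))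
      where
      digit : ∀ i → finToFun {p} {6} (pointAt c t) i ≡ digitsAt c t i
      digit = finToFun-funToFin (digitsAt c t)
      o = Line.offset (lineOf c)
      x = Line.slope (lineOf c)
      h = Line.height (lineOf c)
      at : ∀ i o x → finToFun {p} {6} (pointAt c t) i ≡ residue (o ℤ.+ ⟦ t ⟧ ℤ.* x) →
           ⟦ finToFun {p} {6} (pointAt c t) i ⟧ ≈ o ℤ.+ ⟦ finToFun {p} {6} (pointAt c t) 0F ⟧ ℤ.* x
      at i o x eq = ≈-trans (≈-reflexive (cong ⟦_⟧ eq)) (≈-trans (residue-≈ _)
        (≈-reflexive (cong (λ u → o ℤ.+ ⟦ u ⟧ ℤ.* x) (sym (digit 0F)))))
      positions : ∀ k → Point.position (pointOf (pointAt c t)) k ≈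
        Line.offset (lineOf c) k ℤ.+ Point.time (pointOf (pointAt c t)) ℤ.* Line.slope (lineOf c) k
      positions 0F = at 1F (o 0F) (x 0F) (digit 1F)
      positions 1F = at 2F (o 1F) (x 1F) (digit 2F)
      positions 2F = at 3F (o 2F) (x 2F) (digit 3F)
      positions 3F = at 4F (o 3F) (x 3F) (digit 4F)

    edge : Fin (p ^ 9) → Fin p → Fin (n * m)
    edge c t = combine (inject≤ c p⁹≤n) (inject≤ (pointAt c t) p⁶≤m)

    edges : Fin (p ^ 9 * p) → Fin (n * m)
    edges = uncurry edge ∘ remQuot {p ^ 9} p

    edges-injective : Injective _≡_ _≡_ edges
    edges-injective {x} {y} eq = trans (sym (combine-remQuot {p ^ 9} p x))
      (trans (cong₂ combine (proj₁ same) (proj₂ same)) (combine-remQuot {p ^ 9} p y))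
      where
      same-edge : ∀ c t c′ t′ → edge c t ≡ edge c′ t′ → c ≡ c′ × t ≡ t′
      same-edge c t c′ t′ eq with combine-injective (inject≤ c p⁹≤n) (inject≤ (pointAt c t) p⁶≤m) _ _ eq
      ... | eq₁ , eq₂ = inject≤-injective p⁹≤n p⁹≤n c c′ eq₁ ,
            -- The leading digit of the code of a point is its time, so the endpoint of an edge
            -- determines t.
            trans (sym (finToFun-funToFin (digitsAt c t) 0F))
              (trans (cong (λ d → finToFun {p} {6} d 0F) (inject≤-injective p⁶≤m p⁶≤m (pointAt c t) (pointAt c′ t′) eq₂))
                (finToFun-funToFin (digitsAt c′ t′) 0F))
      same = same-edge (proj₁ (remQuot {p ^ 9} p x)) (proj₂ (remQuot {p ^ 9} p x))
                       (proj₁ (remQuot {p ^ 9} p y)) (proj₂ (remQuot {p ^ 9} p y)) eq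

    abstract
      E : BipartiteEdges n m
      E = proj₁ (image edges edges-injective)

      ∈⇒edge : ∀ {c} → c ∈ E → ∃ λ e → edges e ≡ c
      ∈⇒edge = proj₁ (proj₂ (image edges edges-injective))

      p¹⁰≤∣E∣ : p ^ 9 * p ≤ ∣ E ∣
      p¹⁰≤∣E∣ = proj₂ (proj₂ (image edges edges-injective))

    lineAt : Fin n → Line
    lineAt i = lineOf (wrap i)

    pointAt′ : Fin m → Point
    pointAt′ j = pointOf (wrap j)

    -- Since `wrap` is not injective, an edge also records that its ends are not padding; this turns
    -- equal lines or points back into equal vertices.
    record Inc (i : Fin n) (j : Fin m) : Set where
      constructor inc
      field
        incidence  : Incident (lineAt i) (pointAt′ j)
        line-code  : inject≤ {n = n} (wrap i) p⁹≤n ≡ i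
        point-code : inject≤ {n = m} (wrap j) p⁶≤m ≡ j
    open Inc

    ∈⇒Inc : ∀ {i j} → combine i j ∈ E → Inc i j
    ∈⇒Inc {i} {j} ij∈E with ∈⇒edge ij∈E
    ... | e , eq with combine-injective _ _ i j eq
    ...   | refl , refl = inc
            (subst₂ (λ c d → Incident (lineOf c) (pointOf d)) (sym (wrap-inject≤ p⁹≤n c)) (sym (wrap-inject≤ p⁶≤m d)) (pointAt-incident c t))
            (cong (λ c → inject≤ c p⁹≤n) (wrap-inject≤ p⁹≤n c))
            (cong (λ d → inject≤ d p⁶≤m) (wrap-inject≤ p⁶≤m d))
      where
      c = proj₁ (remQuot {p ^ 9} p e)
      t = proj₂ (remQuot {p ^ 9} p e)
      d = pointAt c t

    same-line : ∀ {i i′ j j′} → Inc i j → Inc i′ j′ → lineAt i ≈ˡ lineAt i′ → i ≡ i′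
    same-line a b h = trans (sym (line-code a)) (trans (cong (λ c → inject≤ c p⁹≤n) (lineOf-injective h)) (line-code b))

    same-point : ∀ {i i′ j j′} → Inc i j → Inc i′ j′ → pointAt′ j ≈ᵖ pointAt′ j′ → j ≡ j′
    same-point a b h = trans (sym (point-code a)) (trans (cong (λ d → inject≤ d p⁶≤m) (pointOf-injective h)) (point-code b))

    no-rectangle : ∀ {i i′ j j′} → Inc i j → Inc i′ j → Inc i j′ → Inc i′ j′ → i ≢ i′ → j ≢ j′ → ⊥
    no-rectangle a b c d i≢i′ j≢j′ =
      [ i≢i′ ∘ same-line a b , j≢j′ ∘ same-point a c ]′
        (two-lines-two-points (incidence a) (incidence b) (incidence c) (incidence d))

    no-θ : ∀ {i j} (P : Fin 4 → Fin m) (M : Fin 4 → Fin n) →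
           (∀ q → Inc i (P q)) → (∀ q → Inc (M q) (P q)) → (∀ q → Inc (M q) j) →
           (∀ {q r} → P q ≡ P r → q ≡ r) → (∀ q → P q ≢ j) → (∀ q → i ≢ M q) → ⊥
    no-θ {i} {j} P M iP MP Mj P-inj P≢j i≢M =
      no-four-paths (pointAt′ ∘ P) (lineAt ∘ M) (incidence ∘ iP) (incidence ∘ MP) (incidence ∘ Mj)
        (λ {q} {r} h → P-inj (same-point (iP q) (iP r) h))
        (λ q h → P≢j q (same-point (iP q) (Mj q) h))
        (λ q h → i≢M q (same-line (iP q) (MP q) h))

    -- Excluding copies of C₄ and θ₃,₄.

    open Graph (bipartite n m E) using (_∼_; Vertex)

    -- An edge with a direction of travel, because a copy may begin in either part.
    data Cross : Vertex → Vertex → Set where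
      lp : ∀ {i j} → Inc i j → Cross (inj₁ i) (inj₂ j)
      pl : ∀ {i j} → Inc i j → Cross (inj₂ j) (inj₁ i)

    cross : ∀ x y → x ∼ y → Cross x y
    cross (inj₁ i) (inj₂ j) (_ , inj₁ ij∈E) = lp (∈⇒Inc ij∈E)
    cross (inj₂ j) (inj₁ i) (_ , inj₂ ij∈E) = pl (∈⇒Inc ij∈E)
    cross (inj₁ _) (inj₁ _) (_ , inj₁ ())
    cross (inj₁ _) (inj₁ _) (_ , inj₂ ())
    cross (inj₁ _) (inj₂ _) (_ , inj₂ ())
    cross (inj₂ _) (inj₂ _) (_ , inj₁ ())
    cross (inj₂ _) (inj₂ _) (_ , inj₂ ())
    cross (inj₂ _) (inj₁ _) (_ , inj₁ ())

    no-closed-walk : ∀ {x y z w} → Cross x y → Cross y z → Cross z w → Cross w x → x ≢ z → y ≢ w → ⊥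
    no-closed-walk (lp a) (pl b) (lp c) (pl d) x≢z y≢w = no-rectangle a b d c (x≢z ∘ cong inj₁) (y≢w ∘ cong inj₂)
    no-closed-walk (pl a) (lp b) (pl c) (lp d) x≢z y≢w = no-rectangle a d b c (y≢w ∘ cong inj₁) (x≢z ∘ cong inj₂)

    C₄-free : ¬ (Cycle 4 ⊑ bipartite n m E)
    C₄-free (f , inj , hom) = no-closed-walk
      (cross (f 0F) (f 1F) (hom {0F} {1F} ((λ ()) , inj₁ refl)))
      (cross (f 1F) (f 2F) (hom {1F} {2F} ((λ ()) , inj₁ refl)))
      (cross (f 2F) (f 3F) (hom {2F} {3F} ((λ ()) , inj₁ refl)))
      (cross (f 3F) (f 0F) (hom {3F} {0F} ((λ ()) , inj₁ refl)))
      (λ eq → contradiction (inj eq) λ ()) (λ eq → contradiction (inj eq) λ ())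

    from-line : ∀ {i y} → Cross (inj₁ i) y → ∃ λ j → y ≡ inj₂ j × Inc i j
    from-line (lp a) = _ , refl , a

    from-point : ∀ {j y} → Cross (inj₂ j) y → ∃ λ i → y ≡ inj₁ i × Inc i j
    from-point (pl a) = _ , refl , a

    -- Paths of odd length have their ends in opposite parts, so one end is a line and the other a
    -- point, in either order.
    no-θ-walk : ∀ x y (u v : Fin 4 → Vertex) →
      (∀ q → Cross x (u q)) → (∀ q → Cross (u q) (v q)) → (∀ q → Cross (v q) y) →
      (∀ {q r} → u q ≡ u r → q ≡ r) → (∀ {q r} → v q ≡ v r → q ≡ r) →
      (∀ q → x ≢ v q) → (∀ q → u q ≢ y) → ⊥
    no-θ-walk (inj₁ i) y u v xu uv vy u-inj v-inj x≢v u≢y =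
      no-θ {i} {j} P M (λ q → proj₂ (proj₂ (A q))) (λ q → proj₂ (proj₂ (B q)))
        (λ q → subst (Inc (M q)) (inj₂-injective (trans (sym (proj₁ (proj₂ (C q)))) (proj₁ (proj₂ (C 0F))))) (proj₂ (proj₂ (C q))))
        (λ {q} {r} eq → u-inj (trans (proj₁ (proj₂ (A q))) (trans (cong inj₂ eq) (sym (proj₁ (proj₂ (A r)))))))
        (λ q eq → u≢y q (trans (proj₁ (proj₂ (A q))) (trans (cong inj₂ eq) (sym (proj₁ (proj₂ (C 0F)))))))
        (λ q eq → x≢v q (trans (cong inj₁ eq) (sym (proj₁ (proj₂ (B q))))))
      where
      A : ∀ q → ∃ λ j → u q ≡ inj₂ j × Inc i j
      A q = from-line (xu q)
      P : Fin 4 → Fin m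
      P q = proj₁ (A q)
      B : ∀ q → ∃ λ i → v q ≡ inj₁ i × Inc i (P q)
      B q = from-point (subst (λ z → Cross z (v q)) (proj₁ (proj₂ (A q))) (uv q))
      M : Fin 4 → Fin n
      M q = proj₁ (B q)
      C : ∀ q → ∃ λ j → y ≡ inj₂ j × Inc (M q) j
      C q = from-line (subst (λ z → Cross z y) (proj₁ (proj₂ (B q))) (vy q))
      j = proj₁ (C 0F)
    -- The source is a point here, so the paths are read backwards: the points P come from v and the
    -- lines M from u.
    no-θ-walk (inj₂ j) y u v xu uv vy u-inj v-inj x≢v u≢y =
      no-θ {i} {j} P M
        (λ q → subst (λ z → Inc z (P q)) (inj₁-injective (trans (sym (proj₁ (proj₂ (C q)))) (proj₁ (proj₂ (C 0F))))) (proj₂ (proj₂ (C q))))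
        (λ q → proj₂ (proj₂ (B q))) (λ q → proj₂ (proj₂ (A q)))
        (λ {q} {r} eq → v-inj (trans (proj₁ (proj₂ (B q))) (trans (cong inj₂ eq) (sym (proj₁ (proj₂ (B r)))))))
        (λ q eq → x≢v q (trans (cong inj₂ (sym eq)) (sym (proj₁ (proj₂ (B q))))))
        (λ q eq → u≢y q (trans (proj₁ (proj₂ (A q))) (trans (cong inj₁ (sym eq)) (sym (proj₁ (proj₂ (C 0F)))))))
      where
      A : ∀ q → ∃ λ i → u q ≡ inj₁ i × Inc i j
      A q = from-point (xu q)
      M : Fin 4 → Fin n
      M q = proj₁ (A q)
      B : ∀ q → ∃ λ j → v q ≡ inj₂ j × Inc (M q) j
      B q = from-line (subst (λ z → Cross z (v q)) (proj₁ (proj₂ (A q))) (uv q))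
      P : Fin 4 → Fin m
      P q = proj₁ (B q)
      C : ∀ q → ∃ λ i → y ≡ inj₁ i × Inc i (P q)
      C q = from-point (subst (λ z → Cross z y) (proj₁ (proj₂ (B q))) (vy q))
      i = proj₁ (C 0F)

    θ-free : ¬ (Theta 3 4 ⊑ bipartite n m E)
    θ-free (f , inj , hom) = no-θ-walk (f source) (f target) (λ q → f (inner q 0F)) (λ q → f (inner q 1F))
      (λ q → cross (f source) (f (inner q 0F)) (hom {source} {inner q 0F} ((λ ()) , inj₁ refl)))
      (λ q → cross (f (inner q 0F)) (f (inner q 1F)) (hom {inner q 0F} {inner q 1F} ((λ ()) , inj₁ (refl , refl))))
      (λ q → cross (f (inner q 1F)) (f target) (hom {inner q 1F} {target} ((λ ()) , inj₁ refl)))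
      (λ eq → inner-injective (inj eq)) (λ eq → inner-injective (inj eq))
      (λ q eq → contradiction (inj eq) λ ()) (λ q eq → contradiction (inj eq) λ ())
      where
      inner-injective : ∀ {q r : Fin 4} {i} → _≡_ {A = ThetaVertex 3 4} (inner q i) (inner r i) → q ≡ r
      inner-injective refl = refl

    lower-bound : p ^ 9 * p ≤ ex n m (Cycle 4 ∷ Theta 3 4 ∷ [])
    lower-bound = ℕ.≤-trans p¹⁰≤∣E∣ (ex-upper E (C₄-free ∷ θ-free ∷ []))

-- Explicit constants and the passage to rational inequalities.

open import Defs
open import Data.List using ([]; _∷_)
open import Data.Fin.Subset using (∣_∣)
open import Data.List.Relation.Unary.All using ([]; _∷_)
open import Data.Nat.Primality using (Prime)
open import Data.Nat as ℕ using (ℕ; zero; suc; _≤_; z≤n; s≤s)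
import Data.Nat.Properties as ℕ
open import Data.Nat.Tactic.RingSolver using (solve-∀)
import Data.Integer as ℤ
import Data.Integer.Properties as ℤ
open import Data.Product using (Σ; ∃; _×_; _,_)
open import Data.Sum using (_⊎_; inj₁; inj₂; [_,_]′)
open import Data.Rational using (ℚ; NonZero; 0ℚ; 1ℚ; _<_; 1/_; Positive; NonNegative; toℚᵘ; +-*-rawSemiring) renaming (_*_ to _*ℚ_; _≤_ to _≤ℚ_)
import Data.Rational.Properties as ℚ
import Data.Rational.Unnormalised as ℚᵘ
import Data.Rational.Unnormalised.Properties as ℚᵘ
import Algebra.Definitions.RawSemiring as RawSemiringDefs
open import Algebra.Bundles using (CommutativeRing)
import Algebra.Properties.CommutativeSemiring.Exp as Exp
open import Relation.Unary using (Pred; Decidable)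
open import Relation.Nullary using (yes; no; contradiction)
open import Relation.Binary.PropositionalEquality
open PrimeDensity using (∃prime; n<m^n)
open UpperBoundCounting using (module UpperBound)
open IncidenceGraph using (module Construction)

open RawSemiringDefs +-*-rawSemiring using () renaming (_^_ to _^ℚ_)
open Exp (CommutativeRing.commutativeSemiring ℚ.+-*-commutativeRing) using (^-distrib-*)

-- `fromℕ a` is normalised through a gcd; the unnormalised fraction is easier to compare and
-- multiply. The stored 0 is the denominator minus one.
toℚᵘ-fromℕ : ∀ a → toℚᵘ (fromℕ a) ℚᵘ.≃ ℚᵘ.mkℚᵘ (ℤ.+ a) 0
toℚᵘ-fromℕ a = ℚ.toℚᵘ-fromℚᵘ (ℚᵘ.mkℚᵘ (ℤ.+ a) 0)

fromℕ-mono : ∀ {a b} → a ≤ b → fromℕ a ≤ℚ fromℕ b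
fromℕ-mono {a} {b} a≤b = ℚ.toℚᵘ-cancel-≤ (begin
  toℚᵘ (fromℕ a)       ≃⟨ toℚᵘ-fromℕ a ⟩
  ℚᵘ.mkℚᵘ (ℤ.+ a) 0    ≤⟨ ℚᵘ.*≤* (ℤ.*-monoʳ-≤-nonNeg (ℤ.+ 1) (ℤ.+≤+ a≤b)) ⟩
  ℚᵘ.mkℚᵘ (ℤ.+ b) 0    ≃⟨ toℚᵘ-fromℕ b ⟨
  toℚᵘ (fromℕ b)       ∎)
  where open ℚᵘ.≤-Reasoning

fromℕ-* : ∀ a b → fromℕ (a ℕ.* b) ≡ fromℕ a *ℚ fromℕ b
fromℕ-* a b = ℚ.toℚᵘ-injective (begin
  toℚᵘ (fromℕ (a ℕ.* b))                         ≈⟨ toℚᵘ-fromℕ (a ℕ.* b) ⟩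
  ℚᵘ.mkℚᵘ (ℤ.+ (a ℕ.* b)) 0                       ≈⟨ ℚᵘ.*≡* (cong (ℤ._* ℤ.+ 1) (ℤ.pos-* a b)) ⟩
  ℚᵘ.mkℚᵘ (ℤ.+ a) 0 ℚᵘ.* ℚᵘ.mkℚᵘ (ℤ.+ b) 0        ≈⟨ ℚᵘ.*-cong (toℚᵘ-fromℕ a) (toℚᵘ-fromℕ b) ⟨
  toℚᵘ (fromℕ a) ℚᵘ.* toℚᵘ (fromℕ b)              ≈⟨ ℚ.toℚᵘ-homo-* (fromℕ a) (fromℕ b) ⟨
  toℚᵘ (fromℕ a *ℚ fromℕ b)                       ∎)
  where open ℚᵘ.≃-Reasoning

fromℕ-^ : ∀ a k → fromℕ (a ℕ.^ k) ≡ fromℕ a ^ℚ k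
fromℕ-^ a zero    = refl
fromℕ-^ a (suc k) = trans (fromℕ-* a (a ℕ.^ k)) (cong (fromℕ a *ℚ_) (fromℕ-^ a k))

fromℕ-positive : ∀ k .{{_ : ℕ.NonZero k}} → Positive (fromℕ k)
fromℕ-positive k = ℚ.normalize-pos k 1

fromℕ-nonZero : ∀ k .{{_ : ℕ.NonZero k}} → NonZero (fromℕ k)
fromℕ-nonZero k = ℚ.pos⇒nonZero (fromℕ k) {{fromℕ-positive k}}

recip : ∀ k .{{_ : ℕ.NonZero k}} → ℚ
recip k = 1/_ (fromℕ k) {{fromℕ-nonZero k}}

recip-positive : ∀ k .{{_ : ℕ.NonZero k}} → Positive (recip k)
recip-positive k = ℚ.1/pos⇒pos (fromℕ k) {{fromℕ-positive k}}

1^ℚ : ∀ q → 1ℚ ^ℚ q ≡ 1ℚ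
1^ℚ zero    = refl
1^ℚ (suc q) = trans (ℚ.*-identityˡ (1ℚ ^ℚ q)) (1^ℚ q)

^ℚ-nonNegative : ∀ c → NonNegative c → ∀ q → NonNegative (c ^ℚ q)
^ℚ-nonNegative c h zero    = _
^ℚ-nonNegative c h (suc q) = ℚ.nonNeg*nonNeg⇒nonNeg c {{h}} (c ^ℚ q) {{^ℚ-nonNegative c h q}}

≤-scaled : ∀ e n p q k .{{_ : ℕ.NonZero q}} → e ℕ.^ q ≤ k ℕ.^ q ℕ.* n ℕ.^ p → e ≤ fromℕ k · n ^[ p / q ]
≤-scaled e n p q k h = subst₂ _≤ℚ_ (fromℕ-^ e q)
  (trans (fromℕ-* (k ℕ.^ q) (n ℕ.^ p)) (cong (_*ℚ fromℕ (n ℕ.^ p)) (fromℕ-^ k q))) (fromℕ-mono h)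

-- For a constant 1/k the inequality of q-th powers follows from one between naturals, on
-- multiplying by (1/k)^q.
scaled-≤ : ∀ e n p q k .{{_ : ℕ.NonZero q}} .{{_ : ℕ.NonZero k}} → n ℕ.^ p ≤ k ℕ.^ q ℕ.* e ℕ.^ q → recip k · n ^[ p / q ]≤ e
scaled-≤ e n p q k h = begin
  r ^ℚ q *ℚ fromℕ (n ℕ.^ p)
    ≤⟨ ℚ.*-monoˡ-≤-nonNeg (r ^ℚ q) {{^ℚ-nonNegative r (ℚ.pos⇒nonNeg r {{recip-positive k}}) q}} (fromℕ-mono h) ⟩
  r ^ℚ q *ℚ fromℕ (k ℕ.^ q ℕ.* e ℕ.^ q)
    ≡⟨ cong (r ^ℚ q *ℚ_) (trans (fromℕ-* (k ℕ.^ q) (e ℕ.^ q)) (cong₂ _*ℚ_ (fromℕ-^ (k) q) (fromℕ-^ e q))) ⟩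
  r ^ℚ q *ℚ (fromℕ (k) ^ℚ q *ℚ fromℕ e ^ℚ q)
    ≡⟨ ℚ.*-assoc (r ^ℚ q) (fromℕ (k) ^ℚ q) (fromℕ e ^ℚ q) ⟨
  r ^ℚ q *ℚ fromℕ (k) ^ℚ q *ℚ fromℕ e ^ℚ q
    ≡⟨ cong (_*ℚ fromℕ e ^ℚ q) (trans (sym (^-distrib-* r (fromℕ (k)) q))
         (trans (cong (_^ℚ q) (ℚ.*-inverseˡ (fromℕ (k)) {{fromℕ-nonZero k}})) (1^ℚ q))) ⟩
  1ℚ *ℚ fromℕ e ^ℚ q
    ≡⟨ ℚ.*-identityˡ (fromℕ e ^ℚ q) ⟩
  fromℕ e ^ℚ q ∎
  where
  open ℚ.≤-Reasoning
  r = recip k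

^-distribʳ-* : ∀ a b k → (a ℕ.* b) ℕ.^ k ≡ a ℕ.^ k ℕ.* b ℕ.^ k
^-distribʳ-* a b zero    = refl
^-distribʳ-* a b (suc k) = trans (cong (a ℕ.* b ℕ.*_) (^-distribʳ-* a b k)) (interchange a b (a ℕ.^ k) (b ℕ.^ k))
  where
  interchange : ∀ a b x y → a ℕ.* b ℕ.* (x ℕ.* y) ≡ a ℕ.* x ℕ.* (b ℕ.* y)
  interchange = solve-∀

^-swap : ∀ a k l → (a ℕ.^ k) ℕ.^ l ≡ (a ℕ.^ l) ℕ.^ k
^-swap a k l = trans (ℕ.^-*-assoc a k l) (trans (cong (a ℕ.^_) (ℕ.*-comm k l)) (sym (ℕ.^-*-assoc a l k)))

^-cancelˡ-≤ : ∀ {a b} k → a ℕ.^ suc k ≤ b ℕ.^ suc k → a ≤ b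
^-cancelˡ-≤ k h = ℕ.≮⇒≥ λ b<a → ℕ.<⇒≱ (ℕ.^-monoˡ-< (suc k) b<a) h

-- The default value 0 satisfies any upper bound, so bounding `ex` from above does not require
-- exhibiting a free graph.
greatest-zero-or-holds : ∀ {ℓ} {P : Pred ℕ ℓ} (P? : Decidable P) b → greatest P? b ≡ 0 ⊎ P (greatest P? b)
greatest-zero-or-holds P? zero = inj₁ refl
greatest-zero-or-holds P? (suc b) with P? (suc b)
... | yes p = inj₂ p
... | no  _ = greatest-zero-or-holds P? b

-- A discrete intermediate value argument, used to find the consecutive thresholds between which n
-- lies.
crossing : ∀ (f : ℕ → ℕ) {n} j k → f j ≤ n → n ℕ.< f (k ℕ.+ j) → ∃ λ i → j ≤ i × f i ≤ n × n ℕ.< f (suc i)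
crossing f j zero    fj≤n n<fj = contradiction fj≤n (ℕ.<⇒≱ n<fj)
crossing f {n} j (suc k) fj≤n n<f with f (suc j) ℕ.≤? n
... | no  ≰n = j , ℕ.≤-refl , fj≤n , ℕ.≰⇒> ≰n
... | yes ≤n with crossing f (suc j) k ≤n (subst (λ i → n ℕ.< f i) (sym (ℕ.+-suc k j)) n<f)
...   | i , j<i , rest = i , ℕ.<⇒≤ j<i , rest

-- The cutoffs a = T and b = T⁴ balance the three terms of `edges-bound`: n a and m b are at most
-- T¹⁰ each, and 3 n m / (a b) is at most 3 T¹⁰.
ex≤5T¹⁰ : ∀ n m T .{{_ : ℕ.NonZero T}} → n ≤ T ℕ.^ 9 → m ≤ T ℕ.^ 6 →
           ex n m (Cycle 4 ∷ Theta 3 4 ∷ []) ≤ 5 ℕ.* T ℕ.^ 10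
ex≤5T¹⁰ n m T n≤T⁹ m≤T⁶ =
  [ (λ e≡0 → subst (_≤ 5 ℕ.* T ℕ.^ 10) (sym e≡0) z≤n) , attained ]′
    (greatest-zero-or-holds (attainable? n m (Cycle 4 ∷ Theta 3 4 ∷ [])) (n ℕ.* m))
  where
  open ℕ.≤-Reasoning
  collect : ∀ x y → x ℕ.* y ℕ.+ y ℕ.* x ℕ.+ x ℕ.* (y ℕ.* 3) ≡ 5 ℕ.* (x ℕ.* y)
  collect = solve-∀
  attained : ∀ {e} → Attainable n m (Cycle 4 ∷ Theta 3 4 ∷ []) e → e ≤ 5 ℕ.* T ℕ.^ 10
  attained (E , (¬C₄ ∷ ¬θ ∷ []) , refl) = ℕ.*-cancelʳ-≤ ∣ E ∣ (5 ℕ.* T ℕ.^ 10) (T ℕ.^ 5) {{ℕ.m^n≢0 T 5}} (begin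
    ∣ E ∣ ℕ.* (T ℕ.* T ℕ.^ 4)
      ≤⟨ UpperBound.edges-bound E ¬C₄ ¬θ T (T ℕ.^ 4) ⟩
    n ℕ.* T ℕ.^ 6 ℕ.+ m ℕ.* (T ℕ.^ 4 ℕ.* T ℕ.^ 5) ℕ.+ n ℕ.* (m ℕ.* 3)
      ≤⟨ ℕ.+-mono-≤ (ℕ.+-mono-≤ (ℕ.*-monoˡ-≤ (T ℕ.^ 6) n≤T⁹) (ℕ.*-monoˡ-≤ (T ℕ.^ 4 ℕ.* T ℕ.^ 5) m≤T⁶)) (ℕ.*-mono-≤ n≤T⁹ (ℕ.*-monoˡ-≤ 3 m≤T⁶)) ⟩
    T ℕ.^ 9 ℕ.* T ℕ.^ 6 ℕ.+ T ℕ.^ 6 ℕ.* (T ℕ.^ 4 ℕ.* T ℕ.^ 5) ℕ.+ T ℕ.^ 9 ℕ.* (T ℕ.^ 6 ℕ.* 3)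
      ≡⟨ cong (λ z → T ℕ.^ 9 ℕ.* T ℕ.^ 6 ℕ.+ T ℕ.^ 6 ℕ.* z ℕ.+ T ℕ.^ 9 ℕ.* (T ℕ.^ 6 ℕ.* 3)) (sym (ℕ.^-distribˡ-+-* T 4 5)) ⟩
    T ℕ.^ 9 ℕ.* T ℕ.^ 6 ℕ.+ T ℕ.^ 6 ℕ.* T ℕ.^ 9 ℕ.+ T ℕ.^ 9 ℕ.* (T ℕ.^ 6 ℕ.* 3)
      ≡⟨ collect (T ℕ.^ 9) (T ℕ.^ 6) ⟩
    5 ℕ.* (T ℕ.^ 9 ℕ.* T ℕ.^ 6)
      ≡⟨ cong (5 ℕ.*_) (trans (sym (ℕ.^-distribˡ-+-* T 9 6)) (ℕ.^-distribˡ-+-* T 10 5)) ⟩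
    5 ℕ.* (T ℕ.^ 10 ℕ.* T ℕ.^ 5)
      ≡⟨ ℕ.*-assoc 5 (T ℕ.^ 10) (T ℕ.^ 5) ⟨
    5 ℕ.* T ℕ.^ 10 ℕ.* T ℕ.^ 5 ∎)

-- Abstract because these numerals are too large to unfold.
abstract
  C₁ C₂ : ℕ
  -- `C₁` comes from p¹⁰ edges with n ≤ (64 p)⁹, and `C₂` from `ex≤5T¹⁰` at T = 2 N.
  C₁ = 64 ℕ.^ 10
  C₂ = 5 ℕ.* 2 ℕ.^ 10

  C₁≢0 : ℕ.NonZero C₁
  C₁≢0 = _

  C₂≢0 : ℕ.NonZero C₂
  C₂≢0 = _

  -- The ninth power of the upper end of the interval in which `∃prime i` finds its prime. The next
  -- threshold is (64 · 4^i)⁹, hence at most (64 p)⁹.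
  threshold : ℕ → ℕ
  threshold i = (16 ℕ.* 2 ℕ.^ (2 ℕ.* i)) ℕ.^ 9

m≤T⁶ : ∀ n m T → n ≤ T ℕ.^ 9 → m ℕ.^ 3 ≤ n ℕ.^ 2 → m ≤ T ℕ.^ 6
m≤T⁶ n m T n≤T⁹ m³≤n² = ^-cancelˡ-≤ 2 (begin
  m ℕ.^ 3              ≤⟨ m³≤n² ⟩
  n ℕ.^ 2              ≤⟨ ℕ.^-monoˡ-≤ 2 n≤T⁹ ⟩
  (T ℕ.^ 9) ℕ.^ 2      ≡⟨ trans (ℕ.^-*-assoc T 9 2) (sym (ℕ.^-*-assoc T 6 3)) ⟩
  (T ℕ.^ 6) ℕ.^ 3      ∎)
  where open ℕ.≤-Reasoning

scale¹⁰ : ∀ a b N → a ℕ.* (b ℕ.* N) ℕ.^ 10 ≡ a ℕ.* b ℕ.^ 10 ℕ.* N ℕ.^ 10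
scale¹⁰ a b N = trans (cong (a ℕ.*_) (^-distribʳ-* b N 10)) (sym (ℕ.*-assoc a (b ℕ.^ 10) (N ℕ.^ 10)))

abstract
  5*[2N]¹⁰ : ∀ N → 5 ℕ.* (2 ℕ.* N) ℕ.^ 10 ≡ C₂ ℕ.* N ℕ.^ 10
  5*[2N]¹⁰ = scale¹⁰ 5 2

  [64p]¹⁰ : ∀ p → (64 ℕ.* p) ℕ.^ 10 ≡ C₁ ℕ.* p ℕ.^ 10
  [64p]¹⁰ p = ^-distribʳ-* 64 p 10

  below-threshold : ∀ {n p i} → p ≤ 16 ℕ.* 2 ℕ.^ (2 ℕ.* i) → threshold i ≤ n → p ℕ.^ 9 ≤ n
  below-threshold p≤ h = ℕ.≤-trans (ℕ.^-monoˡ-≤ 9 p≤) h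

  above-threshold : ∀ {n p} i → 2 ℕ.^ (2 ℕ.* i) ≤ p → n ℕ.< threshold (suc i) → n ≤ (64 ℕ.* p) ℕ.^ 9
  above-threshold {n} {p} i ≤p h = ℕ.≤-trans (ℕ.<⇒≤ h) (ℕ.^-monoˡ-≤ 9 (begin
    16 ℕ.* 2 ℕ.^ (2 ℕ.* suc i)       ≡⟨ cong (λ k → 16 ℕ.* 2 ℕ.^ k) (ℕ.*-suc 2 i) ⟩
    16 ℕ.* 2 ℕ.^ (2 ℕ.+ 2 ℕ.* i)     ≡⟨ cong (16 ℕ.*_) (ℕ.^-distribˡ-+-* 2 2 (2 ℕ.* i)) ⟩
    16 ℕ.* (4 ℕ.* 2 ℕ.^ (2 ℕ.* i))   ≡⟨ ℕ.*-assoc 16 4 (2 ℕ.^ (2 ℕ.* i)) ⟨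
    64 ℕ.* 2 ℕ.^ (2 ℕ.* i)           ≤⟨ ℕ.*-monoʳ-≤ 64 ≤p ⟩
    64 ℕ.* p                         ∎))
    where open ℕ.≤-Reasoning

  i<threshold : ∀ i → i ℕ.< threshold i
  i<threshold i = begin-strict
    i                                  ≤⟨ ℕ.m≤m+n i (i ℕ.+ 0) ⟩
    2 ℕ.* i                            <⟨ n<m^n 2 (2 ℕ.* i) ℕ.≤-refl ⟩
    x                                  ≤⟨ ℕ.m≤n*m x 16 ⟩
    16 ℕ.* x                           ≤⟨ ℕ.m≤m*n (16 ℕ.* x) ((16 ℕ.* x) ℕ.^ 8) {{ℕ.m^n≢0 (16 ℕ.* x) 8 {{ℕ.m*n≢0 16 x {{_}} {{ℕ.m^n≢0 2 (2 ℕ.* i)}}}}}} ⟩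
    threshold i                        ∎
    where
    open ℕ.≤-Reasoning
    x : ℕ
    x = 2 ℕ.^ (2 ℕ.* i)

module _ (n : ℕ) (0<n : 0 ℕ.< n) where

  private
    N e : ℕ
    N = ⌊ n ^ 1 / 9 ⌋
    e = ex n ⌊ n ^ 2 / 3 ⌋ (Cycle 4 ∷ Theta 3 4 ∷ [])

    n^1≡n : n ℕ.^ 1 ≡ n
    n^1≡n = ℕ.^-identityʳ n

    suc≤double : ∀ {k} → 0 ℕ.< k → suc k ≤ 2 ℕ.* k
    suc≤double {k} 0<k = ℕ.+-mono-≤ 0<k (ℕ.≤-reflexive (sym (ℕ.+-identityʳ k)))

    N>0 : 0 ℕ.< N
    N>0 = ℕ.n≢0⇒n>0 λ N≡0 → ℕ.<⇒≱ (subst (λ k → n ℕ.^ 1 ℕ.< suc k ℕ.^ 9) N≡0 (floor-upper n 1 9))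
      (subst (1 ≤_) (sym n^1≡n) 0<n)

    -- Positivity of n gives N ≥ 1, so rounding the ninth root up to N + 1 costs at most a factor of
    -- two.
    n≤[2N]⁹ : n ≤ (2 ℕ.* N) ℕ.^ 9
    n≤[2N]⁹ = ℕ.≤-trans (subst (_≤ suc N ℕ.^ 9) n^1≡n (ℕ.<⇒≤ (floor-upper n 1 9)))
                (ℕ.^-monoˡ-≤ 9 (suc≤double N>0))

    e≤C₂N¹⁰ : e ≤ C₂ ℕ.* N ℕ.^ 10
    e≤C₂N¹⁰ = subst (e ≤_) (5*[2N]¹⁰ N)
      (ex≤5T¹⁰ n ⌊ n ^ 2 / 3 ⌋ (2 ℕ.* N) {{ℕ.>-nonZero (ℕ.<-≤-trans N>0 (ℕ.m≤m+n N _))}} n≤[2N]⁹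
        (m≤T⁶ n ⌊ n ^ 2 / 3 ⌋ (2 ℕ.* N) n≤[2N]⁹ (floor-lower n 2 3)))

  ex⁹-upper : e ℕ.^ 9 ≤ C₂ ℕ.^ 9 ℕ.* n ℕ.^ 10
  ex⁹-upper = begin
    e ℕ.^ 9                          ≤⟨ ℕ.^-monoˡ-≤ 9 e≤C₂N¹⁰ ⟩
    (C₂ ℕ.* N ℕ.^ 10) ℕ.^ 9          ≡⟨ ^-distribʳ-* C₂ (N ℕ.^ 10) 9 ⟩
    C₂ ℕ.^ 9 ℕ.* (N ℕ.^ 10) ℕ.^ 9    ≡⟨ cong (C₂ ℕ.^ 9 ℕ.*_) (^-swap N 10 9) ⟩
    C₂ ℕ.^ 9 ℕ.* (N ℕ.^ 9) ℕ.^ 10    ≤⟨ ℕ.*-monoʳ-≤ (C₂ ℕ.^ 9) (ℕ.^-monoˡ-≤ 10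
                                          (subst (N ℕ.^ 9 ≤_) n^1≡n (floor-lower n 1 9))) ⟩
    C₂ ℕ.^ 9 ℕ.* n ℕ.^ 10            ∎
    where open ℕ.≤-Reasoning

module _ (n : ℕ) (large : threshold 4 ≤ n) where

  private
    e : ℕ
    e = ex n ⌊ n ^ 2 / 3 ⌋ (Cycle 4 ∷ Theta 3 4 ∷ [])

    -- The p⁶ points fit into the smaller part: otherwise the cube of its size plus one would be at
    -- most p¹⁸ ≤ n², against the definition of the floor.
    p¹⁰≤e : ∀ {p} → Prime p → 2 ℕ.< p → p ℕ.^ 9 ≤ n → p ℕ.^ 10 ≤ e
    p¹⁰≤e {p} pp 2<p p⁹≤n = subst (_≤ e) (ℕ.*-comm (p ℕ.^ 9) p)
      (Construction.lower-bound pp 2<p p⁹≤n (ℕ.≤-pred (ℕ.≰⇒> λ m<p⁶ → ℕ.<⇒≱ (floor-upper n 2 3) (begin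
        suc ⌊ n ^ 2 / 3 ⌋ ℕ.^ 3   ≤⟨ ℕ.^-monoˡ-≤ 3 m<p⁶ ⟩
        (p ℕ.^ 6) ℕ.^ 3           ≡⟨ trans (ℕ.^-*-assoc p 6 3) (sym (ℕ.^-*-assoc p 9 2)) ⟩
        (p ℕ.^ 9) ℕ.^ 2           ≤⟨ ℕ.^-monoˡ-≤ 2 p⁹≤n ⟩
        n ℕ.^ 2                   ∎))))
      where open ℕ.≤-Reasoning

    from-prime : ∀ {p} → p ℕ.^ 10 ≤ e → n ≤ (64 ℕ.* p) ℕ.^ 9 → n ℕ.^ 10 ≤ C₁ ℕ.^ 9 ℕ.* e ℕ.^ 9
    from-prime {p} p¹⁰≤e n≤ = begin
      n ℕ.^ 10                          ≤⟨ ℕ.^-monoˡ-≤ 10 n≤ ⟩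
      ((64 ℕ.* p) ℕ.^ 9) ℕ.^ 10         ≡⟨ ^-swap (64 ℕ.* p) 9 10 ⟩
      ((64 ℕ.* p) ℕ.^ 10) ℕ.^ 9         ≡⟨ cong (ℕ._^ 9) ([64p]¹⁰ p) ⟩
      (C₁ ℕ.* p ℕ.^ 10) ℕ.^ 9           ≤⟨ ℕ.^-monoˡ-≤ 9 (ℕ.*-mono-≤ (ℕ.≤-refl {C₁}) p¹⁰≤e) ⟩
      (C₁ ℕ.* e) ℕ.^ 9              ≡⟨ ^-distribʳ-* (C₁) e 9 ⟩
      C₁ ℕ.^ 9 ℕ.* e ℕ.^ 9          ∎
      where open ℕ.≤-Reasoning

    from-crossing : (∃ λ i → 4 ≤ i × threshold i ≤ n × n ℕ.< threshold (suc i)) →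
                    n ℕ.^ 10 ≤ C₁ ℕ.^ 9 ℕ.* e ℕ.^ 9
    from-crossing (i , 4≤i , above , below) =
      let p , pp , 4^i<p , p≤ = ∃prime i 4≤i in
      from-prime {p} (p¹⁰≤e pp (ℕ.≤-<-trans (2≤4^i i (ℕ.≤-trans (s≤s z≤n) 4≤i)) 4^i<p) (below-threshold p≤ above))
        (above-threshold i (ℕ.<⇒≤ 4^i<p) below)
      where
      2≤4^i : ∀ i → 1 ≤ i → 2 ≤ 2 ℕ.^ (2 ℕ.* i)
      2≤4^i i 1≤i = ℕ.^-monoʳ-≤ 2 {1} (ℕ.≤-trans 1≤i (ℕ.m≤m+n i _))

  ex⁹-lower : n ℕ.^ 10 ≤ C₁ ℕ.^ 9 ℕ.* e ℕ.^ 9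
  -- The search starts at 4, where `∃prime` begins to apply, and n steps suffice because
  -- `threshold (n + 4)` already exceeds n.
  ex⁹-lower = from-crossing (crossing threshold 4 n large
    (ℕ.≤-<-trans (ℕ.m≤m+n n 4) (i<threshold (n ℕ.+ 4))))

lower : ∀ n e → n ℕ.^ 10 ≤ C₁ ℕ.^ 9 ℕ.* e ℕ.^ 9 → recip C₁ {{C₁≢0}} · n ^[ 10 / 9 ]≤ e
lower n e = scaled-≤ e n 10 9 C₁ {{_}} {{C₁≢0}}

upper : ∀ n e → e ℕ.^ 9 ≤ C₂ ℕ.^ 9 ℕ.* n ℕ.^ 10 → e ≤ fromℕ C₂ · n ^[ 10 / 9 ]
upper n e = ≤-scaled e n 10 9 C₂

corollary1p3 : Σ ℚ λ c₁ → Σ ℚ λ c₂ → Σ ℕ λ n₀ →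
    0ℚ < c₁ × 0ℚ < c₂ ×
    (∀ n → n₀ ≤ n →
    (c₁ · n ^[ 10 / 9 ]≤ ex n ⌊ n ^ 2 / 3 ⌋ (Cycle 4 ∷ Theta 3 4 ∷ [])) ×
    (ex n ⌊ n ^ 2 / 3 ⌋ (Cycle 4 ∷ Theta 3 4 ∷ []) ≤ c₂ · n ^[ 10 / 9 ]))
corollary1p3 = recip C₁ {{C₁≢0}} , fromℕ C₂ , threshold 4
  , ℚ.positive⁻¹ (recip C₁ {{C₁≢0}}) {{recip-positive C₁ {{C₁≢0}}}}
  , ℚ.positive⁻¹ (fromℕ C₂) {{fromℕ-positive C₂ {{C₂≢0}}}}
  , λ n large →
      lower n (ex n ⌊ n ^ 2 / 3 ⌋ (Cycle 4 ∷ Theta 3 4 ∷ [])) (ex⁹-lower n large)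
    , upper n (ex n ⌊ n ^ 2 / 3 ⌋ (Cycle 4 ∷ Theta 3 4 ∷ []))
        (ex⁹-upper n (ℕ.≤-trans (ℕ.≤-trans (s≤s z≤n) (i<threshold 4)) large))
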